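{- For $i\in\{0,1,2\}$ and $N\ge 0$, let $N_d(i,3;N)$ be the number of partitions of $N$ with designated summands whose pd-rank is congruent to $i$ modulo $3$. Then for every $n\ge0$, $$N_d(0,3;3n+2)=N_d(1,3;3n+2)=N_d(2,3;3n+2).$$
   Context: A partition of $N$ with designated summands is an ordinary partition of $N$ in which, for each part size $t$ that occurs, say $m_t$ times, the copies of $t$ are regarded as ordered (positions $1,\dots,m_t$) and exactly one position $i\in\{1,\dots,m_t\}$ is designated; different positions give different objects. The map $\Phi$: let $\gamma$ be a partition in which no part occurs exactly once, with multiplicity $m_k$ of part $k$. Write uniquely $m_k=s_k+t_k$ with $s_k\in\{0,3\}$ and $t_k\in\{0,2,4,6,\dots\}$. Then $\Phi(\gamma)$ is the partition whose multiplicity $b_j$ of part $j$ is: $b_{6k+1}=b_{6k+5}=0$, $b_{6k+2}=t_{3k+1}/2$, $b_{6k+4}=t_{3k+2}/2$, $b_{6k+3}=s_{2k+1}/3$, $b_{6k+6}=s_{2k+2}/3+t_{3k+3}/2$ (for $k\ge0$). (Equivalently, $t_k$ copies of $k$ become $t_k/2$ copies of $2k$, and $s_k=3$ copies of $k$ become one copy of $3k$.) Its parts are all $\not\equiv\pm1\pmod 6$. The map $\Delta$: given a partition $\lambda$ with designated summands, for each part size $t$ occurring $m_t$ times with designated position $i$: if $i=1$, put all $m_t$ copies of $t$ into $\alpha$; if $i\ge2$, put $i$ copies of $t$ into $\gamma$ and $m_t-i$ copies of $t$ into $\alpha$. Then every part of $\gamma$ occurs at least twice; set $\beta=\Phi(\gamma)$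 and $\Delta(\lambda)=(\alpha,\beta)$. The pd-rank of $\lambda$ is $r_d(\lambda)=l_e(\alpha)-l_e(\beta)$, where $(\alpha,\beta)=\Delta(\lambda)$ and $l_e(\mu)$ is the number of even parts of $\mu$ (counted with multiplicity). -}

module Defs where

open import Data.Nat using (ℕ; zero; suc; _+_; _*_; _∸_; _/_; _%_; _≡ᵇ_)
open import Data.Fin using (Fin; toℕ)
open import Data.Vec using (Vec; []; _∷_)
open import Data.List using (List; []; _∷_; _++_; replicate)
open import Data.Product using (Σ; _×_; _,_; proj₁; proj₂)
open import Data.Unit using (⊤; tt)
open import Data.Bool using (if_then_else_)
open import Data.Integer using (ℤ; +_; _-_)
open import Data.Integer.DivMod using (_%ℕ_)
open import Relation.Binary.PropositionalEquality using (_≡_)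

-- Partitions with designated summands.
-- A partition of N is encoded by its multiplicities m_k for part sizes
-- k = 1, ..., N (a Vec of length N; larger parts cannot occur).
-- For each part size with m_k > 0 a designated position in
-- {1, ..., m_k} is chosen, encoded as an element of Fin m_k
-- (Fin element j stands for position j+1).  If m_k = 0 there is no
-- choice (⊤).

Desig : ℕ → Set
Desig zero    = ⊤
Desig (suc m) = Fin (suc m)

Slot : Set
Slot = Σ ℕ Desig

weightFrom : ℕ → {n : ℕ} → Vec Slot n → ℕ
weightFrom k []             = 0
weightFrom k ((m , _) ∷ v)  = k * m + weightFrom (suc k) v

DesignatedPartition : ℕ → Set
DesignatedPartition N = Σ (Vec Slot N) (λ v → weightFrom 1 v ≡ N)

-- The map Φ.  Its input γ is given by its multiplicities, as a list of
-- pairs (part size k , multiplicity m_k) (distinct part sizes).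
-- m_k = s_k + t_k with s_k ∈ {0,3}, t_k even: s_k = 3 iff m_k is odd.

sPart : ℕ → ℕ
sPart m = if (m % 2 ≡ᵇ 1) then 3 else 0

tPart : ℕ → ℕ
tPart m = m ∸ sPart m

Φ : List (ℕ × ℕ) → List ℕ
Φ []            = []
Φ ((k , m) ∷ γ) = replicate (tPart m / 2) (2 * k)
               ++ replicate (sPart m / 3) (3 * k) ++ Φ γ

-- The map Δ.  For a part size k with multiplicity m and designated
-- position i: if i = 1, all m copies go to α; if i ≥ 2, i copies go to
-- γ and m - i copies go to α.

slotSplit : ℕ → Slot → List ℕ × List (ℕ × ℕ)
slotSplit k (zero , _)  = [] , []
slotSplit k (suc m , d) with toℕ d
... | zero  = replicate (suc m) k , []
... | suc j = replicate (suc m ∸ suc (suc j)) k , ((k , suc (suc j)) ∷ [])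

splitFrom : ℕ → {n : ℕ} → Vec Slot n → List ℕ × List (ℕ × ℕ)
splitFrom k []      = [] , []
splitFrom k (s ∷ v) =
  proj₁ (slotSplit k s) ++ proj₁ (splitFrom (suc k) v) ,
  proj₂ (slotSplit k s) ++ proj₂ (splitFrom (suc k) v)

Δ : {N : ℕ} → DesignatedPartition N → List ℕ × List ℕ
Δ (v , _) = proj₁ (splitFrom 1 v) , Φ (proj₂ (splitFrom 1 v))

evenParts : List ℕ → ℕ
evenParts []       = 0
evenParts (x ∷ xs) = (if (x % 2 ≡ᵇ 0) then 1 else 0) + evenParts xs

pdRank : {N : ℕ} → DesignatedPartition N → ℤ
pdRank p = + evenParts (proj₁ (Δ p)) - + evenParts (proj₂ (Δ p))

RankClass : ℕ → ℕ → Set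
RankClass N i = Σ (DesignatedPartition N) (λ p → pdRank p %ℕ 3 ≡ i)

{-# OPTIONS --safe #-}
-- Weight a designated partition by ω^(pd-rank), ω a primitive cube root of unity, so that the three
-- rank classes are equinumerous iff the weighted count vanishes.  A part size k contributes, with
-- e = 1 for k even and e = 0 for k odd,
--
--   (1 + ω^(-e) q^(3k)) / ((1 - ω^e q^k) (1 - ω^(-1) q^(2k))).
--
-- Since (1 - ωx)(1 - ω²x)(1 - x) = 1 - x³, the product over all k is a power series in q³ times
--
--   ∏ (1 - q^(2j)) / (1 - q^(2j-1)) = Σ q^(j(j+1)/2)    (Gauss),
--
-- and no triangular number is 2 modulo 3.  Gauss' identity is needed only up to a given power of q,
-- where it follows from Shanks' finite version of it.
module Submission where

-- The factor of a part size splits because Δ does: the number of copies sent to α and the number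
-- sent to γ vary independently, and the numbers other than 1 are exactly 2t + 3b with b at most 1,
-- uniquely. A pair in γ becomes the part 2k of β, always even, whence ω^(-1) q^(2k); the triple
-- becomes 3k, of the parity of k.
--
-- The cancellation crosses part sizes: the denominator 1 - ω² q^(2j) stems from pairs of size j,
-- its partner 1 - ω q^(2j) from the even size 2j. Partitions of N involve sizes up to N only, so
-- the sizes from N + 1 to 2N are inserted; they do not affect coefficients up to q^N. Hence
-- everything is stated up to a bound N and no infinite product occurs.
--
-- Identities about 1 - x are written without subtraction, since the solver used for them works in
-- commutative semirings: a = (1 - x) b appears as a + x b = b.

open import Defs
open import Algebra.Bundles using (CommutativeRing)
import Algebra.Construct.Pointwise as Pointwise
import Algebra.Properties.CommutativeSemigroup as SemigroupProperties
import Algebra.Properties.Group as GroupProperties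
import Algebra.Properties.Semiring.Exp as Exp
import Algebra.Solver.Ring.NaturalCoefficients.Default as SemiringSolver
open import Data.Nat as ℕ using (ℕ; zero; suc)
import Data.Nat.Properties as ℕₚ
open import Data.Product using (Σ; _×_; _,_; proj₁; proj₂)
open import Level using (Level; 0ℓ)
import Relation.Binary.PropositionalEquality as ≡
import Relation.Binary.Reasoning.Setoid as SetoidReasoning

-- Power series

private
  variable
    ℓ : Level

-- z fills the first k places.
shift : {X : Set ℓ} → X → ℕ → (ℕ → X) → ℕ → X
shift z zero    f n       = f n
shift z (suc k) f zero    = z
shift z (suc k) f (suc n) = shift z k f n

module PowerSeries (R : CommutativeRing 0ℓ 0ℓ) where
  open CommutativeRing R
  open SetoidReasoning setoid
  open SemiringSolver commutativeSemiring

  Series : Set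
  Series = ℕ → Carrier

  infix 4 _≋_
  _≋_ : Series → Series → Set
  f ≋ g = ∀ n → f n ≈ g n

  tail : Series → Series
  tail f n = f (suc n)

  infixl 7 _⊛_
  _⊛_ : Series → Series → Series
  (f ⊛ g) zero    = f 0 * g 0
  (f ⊛ g) (suc n) = f 0 * g (suc n) + (tail f ⊛ g) n

  infixl 6 _⊕_
  _⊕_ : Series → Series → Series
  (f ⊕ g) n = f n + g n

  constant : Carrier → Series
  constant a zero    = a
  constant a (suc n) = 0#

  ⊛-cong : ∀ {f f′ g g′} → f ≋ f′ → g ≋ g′ → f ⊛ g ≋ f′ ⊛ g′
  ⊛-cong p r zero    = *-cong (p 0) (r 0)
  ⊛-cong p r (suc n) = +-cong (*-cong (p 0) (r (suc n))) (⊛-cong (λ m → p (suc m)) r n)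

  ⊛-distribʳ : ∀ h f g → (f ⊕ g) ⊛ h ≋ (f ⊛ h) ⊕ (g ⊛ h)
  ⊛-distribʳ h f g zero    = distribʳ (h 0) (f 0) (g 0)
  ⊛-distribʳ h f g (suc n) = begin
    (f 0 + g 0) * h (suc n) + ((tail f ⊕ tail g) ⊛ h) n
      ≈⟨ +-congˡ (⊛-distribʳ h (tail f) (tail g) n) ⟩
    (f 0 + g 0) * h (suc n) + ((tail f ⊛ h) n + (tail g ⊛ h) n)
      ≈⟨ solve 5 (λ a b c x y → (a :+ b) :* c :+ (x :+ y) := (a :* c :+ x) :+ (b :* c :+ y)) refl
           (f 0) (g 0) (h (suc n)) ((tail f ⊛ h) n) ((tail g ⊛ h) n) ⟩
    (f 0 * h (suc n) + (tail f ⊛ h) n) + (g 0 * h (suc n) + (tail g ⊛ h) n) ∎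

  ⊛-scale : ∀ a f g n → ((λ m → a * f m) ⊛ g) n ≈ a * (f ⊛ g) n
  ⊛-scale a f g zero    = *-assoc a (f 0) (g 0)
  ⊛-scale a f g (suc n) = begin
    a * f 0 * g (suc n) + ((λ m → a * tail f m) ⊛ g) n ≈⟨ +-congˡ (⊛-scale a (tail f) g n) ⟩
    a * f 0 * g (suc n) + a * (tail f ⊛ g) n
      ≈⟨ solve 4 (λ a b c x → a :* b :* c :+ a :* x := a :* (b :* c :+ x)) refl
           a (f 0) (g (suc n)) ((tail f ⊛ g) n) ⟩
    a * (f 0 * g (suc n) + (tail f ⊛ g) n) ∎

  ⊛-assoc : ∀ f g h → (f ⊛ g) ⊛ h ≋ f ⊛ (g ⊛ h)
  ⊛-assoc f g h zero    = *-assoc (f 0) (g 0) (h 0)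
  ⊛-assoc f g h (suc n) = begin
    f 0 * g 0 * h (suc n) + (((λ m → f 0 * tail g m) ⊕ (tail f ⊛ g)) ⊛ h) n
      ≈⟨ +-congˡ (⊛-distribʳ h _ _ n) ⟩
    f 0 * g 0 * h (suc n) + (((λ m → f 0 * tail g m) ⊛ h) n + ((tail f ⊛ g) ⊛ h) n)
      ≈⟨ +-congˡ (+-cong (⊛-scale (f 0) (tail g) h n) (⊛-assoc (tail f) g h n)) ⟩
    f 0 * g 0 * h (suc n) + (f 0 * (tail g ⊛ h) n + (tail f ⊛ (g ⊛ h)) n)
      ≈⟨ solve 5 (λ a b c x y → a :* b :* c :+ (a :* x :+ y) := a :* (b :* c :+ x) :+ y) refl
           (f 0) (g 0) (h (suc n)) ((tail g ⊛ h) n) ((tail f ⊛ (g ⊛ h)) n) ⟩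
    f 0 * (g 0 * h (suc n) + (tail g ⊛ h) n) + (tail f ⊛ (g ⊛ h)) n ∎

  -- The product recurses on its left factor. This is the mirror recursion on the right factor,
  -- which commutativity needs.
  ⊛-tailʳ : ∀ f g n → (f ⊛ g) (suc n) ≈ f (suc n) * g 0 + (f ⊛ tail g) n
  ⊛-tailʳ f g zero    = +-comm _ _
  ⊛-tailʳ f g (suc n) = begin
    f 0 * g (suc (suc n)) + (tail f ⊛ g) (suc n) ≈⟨ +-congˡ (⊛-tailʳ (tail f) g n) ⟩
    f 0 * g (suc (suc n)) + (f (suc (suc n)) * g 0 + (tail f ⊛ tail g) n)
      ≈⟨ solve 3 (λ a b c → a :+ (b :+ c) := b :+ (a :+ c)) refl _ _ _ ⟩
    f (suc (suc n)) * g 0 + (f 0 * g (suc (suc n)) + (tail f ⊛ tail g) n) ∎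

  ⊛-comm : ∀ f g → f ⊛ g ≋ g ⊛ f
  ⊛-comm f g zero    = *-comm _ _
  ⊛-comm f g (suc n) = begin
    f 0 * g (suc n) + (tail f ⊛ g) n ≈⟨ +-cong (*-comm _ _) (⊛-comm (tail f) g n) ⟩
    g (suc n) * f 0 + (g ⊛ tail f) n ≈⟨ ⊛-tailʳ g f n ⟨
    (g ⊛ f) (suc n) ∎

  zero-⊛ : ∀ f → (λ _ → 0#) ⊛ f ≋ (λ _ → 0#)
  zero-⊛ f zero    = zeroˡ _
  zero-⊛ f (suc n) = trans (+-cong (zeroˡ _) (zero-⊛ f n)) (+-identityˡ 0#)

  constant-⊛ : ∀ a f n → (constant a ⊛ f) n ≈ a * f n
  constant-⊛ a f zero    = refl
  constant-⊛ a f (suc n) = trans (+-congˡ (zero-⊛ f n)) (+-identityʳ _)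

  one-⊛ : ∀ f → constant 1# ⊛ f ≋ f
  one-⊛ f n = trans (constant-⊛ 1# f n) (*-identityˡ _)

  series-ring : CommutativeRing 0ℓ 0ℓ
  series-ring = record
    { Carrier = Series ; _≈_ = _≋_ ; _+_ = _⊕_ ; _*_ = _⊛_
    ; -_ = λ f n → - f n ; 0# = λ _ → 0# ; 1# = constant 1#
    ; isCommutativeRing = record
      { isRing = record
        { +-isAbelianGroup = Pointwise.isAbelianGroup ℕ +-isAbelianGroup
        ; *-cong = ⊛-cong
        ; *-assoc = ⊛-assoc
        ; *-identity = one-⊛ , λ f n → trans (⊛-comm f _ n) (one-⊛ f n)
        ; distrib = (λ h f g n → trans (⊛-comm h _ n) (trans (⊛-distribʳ h f g n)
                      (+-cong (⊛-comm f h n) (⊛-comm g h n)))) , ⊛-distribʳ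
        }
      ; *-comm = ⊛-comm
      }
    }

  private module S = CommutativeRing series-ring
  open Exp S.semiring using (_^_) public

  q : Series
  q zero    = 0#
  q (suc n) = constant 1# n

  q-⊛-zero : ∀ f → (q ⊛ f) 0 ≈ 0#
  q-⊛-zero f = zeroˡ _

  q-⊛-suc : ∀ f n → (q ⊛ f) (suc n) ≈ f n
  q-⊛-suc f n = trans (+-cong (zeroˡ _) (one-⊛ f n)) (+-identityˡ _)

  q^-⊛ : ∀ k f → (q ^ k) ⊛ f ≋ shift 0# k f
  q^-⊛ zero    f n       = one-⊛ f n
  q^-⊛ (suc k) f zero    = trans (⊛-assoc q (q ^ k) f 0) (q-⊛-zero ((q ^ k) ⊛ f))
  q^-⊛ (suc k) f (suc n) = trans (⊛-assoc q (q ^ k) f (suc n))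
    (trans (q-⊛-suc ((q ^ k) ⊛ f) n) (q^-⊛ k f n))

-- Shanks' finite form of Gauss' identity

module Geometric (R : CommutativeRing 0ℓ 0ℓ) where
  open CommutativeRing R
  open SetoidReasoning setoid
  open SemiringSolver commutativeSemiring
  open GroupProperties +-group using () renaming (∙-cancelʳ to +-cancelʳ)

  ∏ : (ℕ → Carrier) → ℕ → Carrier
  ∏ f zero    = 1#
  ∏ f (suc n) = ∏ f n * f n

  infix 4 _IsGeometricIn_
  -- That is, `d` is 1 / (1 - x), so that 1 - x can be cancelled.
  record _IsGeometricIn_ (d x : Carrier) : Set where
    constructor geometric
    field unfold : d ≈ 1# + x * d

  open _IsGeometricIn_ public

  -- The hypothesis is (1 - x) f = (1 - x) g, and multiplying by `d` undoes 1 - x.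
  geometric-cancel : ∀ {x d f g} → d IsGeometricIn x → f + x * g ≈ g + x * f → f ≈ g
  geometric-cancel {x} {d} {f} {g} d-geo eq = +-cancelʳ (x * d * f + x * d * g) f g (begin
    f + (x * d * f + x * d * g)
      ≈⟨ solve 4 (λ x d f g → f :+ (x :* d :* f :+ x :* d :* g)
                           := (con 1 :+ x :* d) :* f :+ x :* d :* g) refl x d f g ⟩
    (1# + x * d) * f + x * d * g ≈⟨ +-congʳ (*-congʳ (unfold d-geo)) ⟨
    d * f + x * d * g
      ≈⟨ solve 4 (λ x d f g → d :* f :+ x :* d :* g := d :* (f :+ x :* g)) refl x d f g ⟩
    d * (f + x * g) ≈⟨ *-congˡ eq ⟩
    d * (g + x * f)
      ≈⟨ solve 4 (λ x d f g → d :* (g :+ x :* f) := d :* g :+ x :* d :* f) refl x d f g ⟩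
    d * g + x * d * f ≈⟨ +-congʳ (*-congʳ (unfold d-geo)) ⟩
    (1# + x * d) * g + x * d * f
      ≈⟨ solve 4 (λ x d f g → (con 1 :+ x :* d) :* g :+ x :* d :* f
                           := g :+ (x :* d :* f :+ x :* d :* g)) refl x d f g ⟩
    g + (x * d * f + x * d * g) ∎)

  -- Turns a recursion found by counting into a factor 1 / (1 - x).
  geometric-* : ∀ {x d f g} → d IsGeometricIn x → g ≈ f + x * g → g ≈ d * f
  geometric-* {x} {d} {f} {g} d-geo eq = geometric-cancel d-geo (begin
    g + x * (d * f) ≈⟨ +-congʳ eq ⟩
    f + x * g + x * (d * f)
      ≈⟨ solve 4 (λ x d f g → f :+ x :* g :+ x :* (d :* f)
                           := (con 1 :+ x :* d) :* f :+ x :* g) refl x d f g ⟩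
    (1# + x * d) * f + x * g ≈⟨ +-congʳ (*-congʳ (unfold d-geo)) ⟨
    d * f + x * g ∎)

  -- (1 - wx)(1 - w²x) = 1 + x + x², and both d₁d₂ and (1 - x)d₃ are inverse to it.
  geometric-cube : ∀ {w x d₁ d₂ d₃} → 1# + w + w * w ≈ 0# → w * (w * w) ≈ 1# →
    d₁ IsGeometricIn (w * x) → d₂ IsGeometricIn (w * w * x) →
    d₃ IsGeometricIn (x * x * x) →
    d₁ * d₂ + x * d₃ ≈ d₃
  geometric-cube {w} {x} {d₁} {d₂} {d₃} w-sum w-cube g₁ g₂ g₃ = geometric-cancel g₃ (begin
    h + x * d₃ + x * x * x * d₃ ≈⟨ +-congʳ (+-congˡ (*-congˡ (unfold g₃))) ⟩
    h + x * (1# + x * x * x * d₃) + x * x * x * d₃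
      ≈⟨ solve 3 (λ h x d → h :+ x :* (con 1 :+ x :* x :* x :* d) :+ x :* x :* x :* d
                         := (h :+ x :* con 1) :+ x :* (x :* x :* x :* d) :+ x :* x :* x :* d) refl h x d₃ ⟩
    (h + x * 1#) + x * (x * x * x * d₃) + x * x * x * d₃
      ≈⟨ +-congʳ (+-congʳ (+-congˡ (*-congˡ h-inverse))) ⟨
    (h + x * (h + x * h + x * x * h)) + x * (x * x * x * d₃) + x * x * x * d₃
      ≈⟨ solve 3 (λ h x d →
           (h :+ x :* (h :+ x :* h :+ x :* x :* h)) :+ x :* (x :* x :* x :* d) :+ x :* x :* x :* d
           := (h :+ x :* h :+ x :* x :* h) :+ x :* x :* x :* d :+ x :* x :* x :* (h :+ x :* d))
           refl h x d₃ ⟩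
    (h + x * h + x * x * h) + x * x * x * d₃ + x * x * x * (h + x * d₃)
      ≈⟨ +-congʳ (+-congʳ h-inverse) ⟩
    1# + x * x * x * d₃ + x * x * x * (h + x * d₃) ≈⟨ +-congʳ (unfold g₃) ⟨
    d₃ + x * x * x * (h + x * d₃) ∎)
    where
    h : Carrier
    h = d₁ * d₂

    wxh : 1# + w * x * h ≈ d₁ + x * x * h
    wxh = begin
      -- One expansion of `d₂` brings out w³ = 1 and leaves 1 + w x `d₁`, which is `d₁`.
      1# + w * x * (d₁ * d₂) ≈⟨ +-congˡ (*-congˡ (*-congˡ (unfold g₂))) ⟩
      1# + w * x * (d₁ * (1# + w * w * x * d₂))
        ≈⟨ solve 4 (λ w x d e → con 1 :+ w :* x :* (d :* (con 1 :+ w :* w :* x :* e))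
                             := (con 1 :+ w :* x :* d) :+ w :* (w :* w) :* (x :* x :* (d :* e)))
             refl w x d₁ d₂ ⟩
      (1# + w * x * d₁) + w * (w * w) * (x * x * h)
        ≈⟨ +-cong (sym (unfold g₁)) (trans (*-congʳ w-cube) (*-identityˡ _)) ⟩
      d₁ + x * x * h ∎

    h-inverse : h + x * h + x * x * h ≈ 1#
    h-inverse = +-cancelʳ d₁ _ _ (begin
      d₁ * d₂ + x * h + x * x * h + d₁ ≈⟨ +-congʳ (+-congʳ (+-congʳ (*-congˡ (unfold g₂)))) ⟩
      d₁ * (1# + w * w * x * d₂) + x * h + x * x * h + d₁
        ≈⟨ solve 4 (λ w x d e →
             d :* (con 1 :+ w :* w :* x :* e) :+ x :* (d :* e) :+ x :* x :* (d :* e) :+ d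
             := (d :+ x :* x :* (d :* e)) :+ ((con 1 :+ w :* w) :* (x :* (d :* e)) :+ d))
             refl w x d₁ d₂ ⟩
      (d₁ + x * x * h) + ((1# + w * w) * (x * h) + d₁) ≈⟨ +-congʳ wxh ⟨
      (1# + w * x * h) + ((1# + w * w) * (x * h) + d₁)
        ≈⟨ solve 4 (λ w x h d → (con 1 :+ w :* x :* h) :+ ((con 1 :+ w :* w) :* (x :* h) :+ d)
                             := (con 1 :+ d) :+ (con 1 :+ w :+ w :* w) :* (x :* h)) refl w x h d₁ ⟩
      (1# + d₁) + (1# + w + w * w) * (x * h)
        ≈⟨ +-congˡ (trans (*-congʳ w-sum) (zeroˡ _)) ⟩
      (1# + d₁) + 0# ≈⟨ +-identityʳ _ ⟩
      1# + d₁ ∎)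

  module _ (x w y : ℕ → Carrier) where

    -- Nested in the order in which slots are peeled off a partition, so that the counting induction
    -- yields it as it stands; `∏-from-0` then sorts the three kinds of factor.
    ∏-from : ℕ → ℕ → Carrier
    ∏-from k zero    = 1#
    ∏-from k (suc n) = x k * (w k * (y k * ∏-from (suc k) n))

    ∏-split : ∀ n k → ∏ y k * ∏ w k * ∏ x k * ∏-from k n
                    ≈ ∏ y (n ℕ.+ k) * ∏ w (n ℕ.+ k) * ∏ x (n ℕ.+ k)
    ∏-split zero    k = *-identityʳ _
    ∏-split (suc n) k = begin
      ∏ y k * ∏ w k * ∏ x k * (x k * (w k * (y k * ∏-from (suc k) n)))
        ≈⟨ solve 7 (λ a b c x w y g → a :* b :* c :* (x :* (w :* (y :* g)))
                                   := a :* y :* (b :* w) :* (c :* x) :* g) refl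
             (∏ y k) (∏ w k) (∏ x k) (x k) (w k) (y k) (∏-from (suc k) n) ⟩
      ∏ y (suc k) * ∏ w (suc k) * ∏ x (suc k) * ∏-from (suc k) n ≈⟨ ∏-split n (suc k) ⟩
      ∏ y (n ℕ.+ suc k) * ∏ w (n ℕ.+ suc k) * ∏ x (n ℕ.+ suc k)
        ≡⟨ ≡.cong (λ m → ∏ y m * ∏ w m * ∏ x m) (ℕₚ.+-suc n k) ⟩
      ∏ y (suc n ℕ.+ k) * ∏ w (suc n ℕ.+ k) * ∏ x (suc n ℕ.+ k) ∎

    ∏-from-0 : ∀ n → ∏-from 0 n ≈ ∏ y n * (∏ x n * ∏ w n)
    ∏-from-0 n = begin
      ∏-from 0 n ≈⟨ solve 1 (λ g → g := con 1 :* con 1 :* con 1 :* g) refl (∏-from 0 n) ⟩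
      1# * 1# * 1# * ∏-from 0 n ≈⟨ ∏-split n 0 ⟩
      ∏ y (n ℕ.+ 0) * ∏ w (n ℕ.+ 0) * ∏ x (n ℕ.+ 0)
        ≡⟨ ≡.cong (λ m → ∏ y m * ∏ w m * ∏ x m) (ℕₚ.+-identityʳ n) ⟩
      ∏ y n * ∏ w n * ∏ x n
        ≈⟨ solve 3 (λ a b c → a :* c :* b := a :* (b :* c)) refl (∏ y n) (∏ x n) (∏ w n) ⟩
      ∏ y n * (∏ x n * ∏ w n) ∎

  -- The factor `w j` is to cancel against `x` at index 2j + 1, so twice as many factors `x` as `w`
  -- are taken.
  ∏-regroup : ∀ {x w c p : ℕ → Carrier} →
    (∀ j → x (j ℕ.* 2) * (x (suc (j ℕ.* 2)) * w j) ≈ p j * c j) →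
    ∀ n → ∏ x (n ℕ.* 2) * ∏ w n ≈ ∏ c n * ∏ p n
  ∏-regroup eq zero    = refl
  ∏-regroup {x} {w} {c} {p} eq (suc n) = begin
    ∏ x (n ℕ.* 2) * x (n ℕ.* 2) * x (suc (n ℕ.* 2)) * (∏ w n * w n)
      ≈⟨ solve 5 (λ a x y b w → a :* x :* y :* (b :* w) := a :* b :* (x :* (y :* w))) refl
           (∏ x (n ℕ.* 2)) (x (n ℕ.* 2)) (x (suc (n ℕ.* 2))) (∏ w n) (w n) ⟩
    ∏ x (n ℕ.* 2) * ∏ w n * (x (n ℕ.* 2) * (x (suc (n ℕ.* 2)) * w n)) ≈⟨ *-cong (∏-regroup eq n) (eq n) ⟩
    ∏ c n * ∏ p n * (p n * c n)
      ≈⟨ solve 4 (λ a b c d → a :* b :* (c :* d) := a :* d :* (b :* c)) refl (∏ c n) (∏ p n) (p n) (c n) ⟩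
    ∏ c n * c n * (∏ p n * p n) ∎

  geometric-unfold-* : ∀ {x d} f → d IsGeometricIn x → d * f ≈ f + x * (d * f)
  geometric-unfold-* {x} {d} f g = trans (*-congʳ (unfold g))
    (solve 3 (λ x d f → (con 1 :+ x :* d) :* f := f :+ x :* (d :* f)) refl x d f)

  -- With p = (1 - x)d and h = (1 - x)c.
  exchange : ∀ {x d p h c} → p + x * d ≈ d → h + x * c ≈ c → d * h ≈ p * c
  exchange {x} {d} {p} {h} {c} p-eq h-eq = +-cancelʳ (x * d * c) _ _ (begin
    d * h + x * d * c
      ≈⟨ solve 4 (λ d h x c → d :* h :+ x :* d :* c := d :* (h :+ x :* c)) refl d h x c ⟩
    d * (h + x * c) ≈⟨ *-congˡ h-eq ⟩
    d * c ≈⟨ *-congʳ p-eq ⟨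
    (p + x * d) * c ≈⟨ distribʳ c p (x * d) ⟩
    p * c + x * d * c ∎)

module Shanks (R : CommutativeRing 0ℓ 0ℓ) (q : CommutativeRing.Carrier R) where
  open CommutativeRing R
  open Geometric R
  open SetoidReasoning setoid
  open SemiringSolver commutativeSemiring
  open Exp semiring using (_^_; ^-congˡ)
  open GroupProperties +-group using () renaming (∙-cancelʳ to +-cancelʳ)

  q^2* : ℕ → Carrier
  q^2* zero    = 1#
  q^2* (suc s) = q * q * q^2* s

  module Quotients (d : ℕ → Carrier) (d-geo : ∀ s → d s IsGeometricIn (q * q^2* s))
                   (p : ℕ → Carrier) (p-eq : ∀ s → p s + q * q * q^2* s * d s ≈ d s) where

    -- Here `d s` is 1 / (1 - q^(2s+1)) and `p s` is (1 - q^(2s+2)) / (1 - q^(2s+1)); this is the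
    -- latter with its denominator cleared.
    p-quotient : ∀ s → p s + q * q * q^2* s ≈ 1# + q * q^2* s * p s
    p-quotient s = +-cancelʳ (q * q * v * d s) _ _ (begin
      p s + q * q * v + q * q * v * d s
        ≈⟨ solve 4 (λ p q v d → p :+ q :* q :* v :+ q :* q :* v :* d
                             := (p :+ q :* q :* v :* d) :+ q :* q :* v) refl (p s) q v (d s) ⟩
      (p s + q * q * v * d s) + q * q * v ≈⟨ +-congʳ (trans (p-eq s) (unfold (d-geo s))) ⟩
      (1# + q * v * d s) + q * q * v ≈⟨ +-congʳ (+-congˡ (*-congˡ (p-eq s))) ⟨
      (1# + q * v * (p s + q * q * v * d s)) + q * q * v
        ≈⟨ solve 4 (λ p q v d →
             (con 1 :+ q :* v :* (p :+ q :* q :* v :* d)) :+ q :* q :* v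
             := (con 1 :+ q :* v :* p) :+ q :* q :* v :* (con 1 :+ q :* v :* d)) refl (p s) q v (d s) ⟩
      (1# + q * v * p s) + q * q * v * (1# + q * v * d s) ≈⟨ +-congˡ (*-congˡ (unfold (d-geo s))) ⟨
      (1# + q * v * p s) + q * q * v * d s ∎)
      where
      v : Carrier
      v = q^2* s

    -- B x n = Σ_{r<n} (∏ p n / ∏ p r) x^r.
    B : Carrier → ℕ → Carrier
    B x zero    = 0#
    B x (suc s) = p s * (B x s + x ^ s)

    B-cong : ∀ {x y} → x ≈ y → ∀ s → B x s ≈ B y s
    B-cong x≈y zero    = refl
    B-cong x≈y (suc s) = *-congˡ (+-cong (B-cong x≈y s) (^-congˡ s x≈y))

    ^-q² : ∀ x s → (x * q * q) ^ s ≈ x ^ s * q^2* s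
    ^-q² x zero    = sym (*-identityˡ 1#)
    ^-q² x (suc s) = begin
      x * q * q * (x * q * q) ^ s ≈⟨ *-congˡ (^-q² x s) ⟩
      x * q * q * (x ^ s * q^2* s)
        ≈⟨ solve 4 (λ x q a v → x :* q :* q :* (a :* v) := x :* a :* (q :* q :* v)) refl
             x q (x ^ s) (q^2* s) ⟩
      x * x ^ s * (q * q * q^2* s) ∎

    -- (1 - xq) B (xq²) s - (1 - x) B x s = (1 - q^(2s)) x^s.
    B-functional : ∀ x s → B (x * q * q) s + x * B x s + q^2* s * x ^ s
                         ≈ B x s + x * q * B (x * q * q) s + x ^ s
    B-functional x zero =
      solve 2 (λ x q → con 0 :+ x :* con 0 :+ con 1 :* con 1
                    := con 0 :+ x :* q :* con 0 :+ con 1) refl x q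
    B-functional x (suc s) = begin
      p s * (b′ + (x * q * q) ^ s) + x * (p s * (b + y)) + q * q * v * (x * y)
        ≈⟨ +-congʳ (+-congʳ (*-congˡ (+-congˡ (^-q² x s)))) ⟩
      p s * (b′ + y * v) + x * (p s * (b + y)) + q * q * v * (x * y)
        ≈⟨ solve 7 (λ p b′ y v x b q →
             p :* (b′ :+ y :* v) :+ x :* (p :* (b :+ y)) :+ q :* q :* v :* (x :* y)
             := p :* (b′ :+ x :* b :+ v :* y) :+ x :* y :* (p :+ q :* q :* v)) refl
             (p s) b′ y v x b q ⟩
      p s * (b′ + x * b + v * y) + x * y * (p s + q * q * v)
        ≈⟨ +-cong (*-congˡ (B-functional x s)) (*-congˡ (p-quotient s)) ⟩
      p s * (b + x * q * b′ + y) + x * y * (1# + q * v * p s)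
        ≈⟨ solve 7 (λ p b′ y v x b q →
             p :* (b :+ x :* q :* b′ :+ y) :+ x :* y :* (con 1 :+ q :* v :* p)
             := p :* (b :+ y) :+ x :* q :* (p :* (b′ :+ y :* v)) :+ x :* y) refl
             (p s) b′ y v x b q ⟩
      p s * (b + y) + x * q * (p s * (b′ + y * v)) + x * y
        ≈⟨ +-congʳ (+-congˡ (*-congˡ (*-congˡ (+-congˡ (^-q² x s))))) ⟨
      p s * (b + y) + x * q * (p s * (b′ + (x * q * q) ^ s)) + x * y ∎
      where
      v y b b′ : Carrier
      v  = q^2* s
      y  = x ^ s
      b  = B x s
      b′ = B (x * q * q) s

    x[_] : ℕ → Carrier
    x[ n ] = q * q^2* n

    -- The left side of Shanks' identity. Summing `S-suc` gives the right side, the first 2n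
    -- triangular powers of q.
    S : ℕ → Carrier
    S n = B x[ n ] n

    -- The new terms are q^(n(2n+1)) and q^((n+1)(2n+1)), two consecutive triangular powers.
    S-suc : ∀ n → S (suc n) ≈ S n + x[ n ] ^ n + x[ n ] ^ suc n
    S-suc n = trans
      (*-congˡ (+-cong (B-cong x-suc n) (trans (^-congˡ n x-suc) (^-q² x n))))
      (geometric-cancel (d-geo n) (+-cancelʳ (x * q * (b′ + y * v)) _ _ (begin
        s′ + x * t + x * q * (b′ + y * v)
          ≈⟨ solve 7 (λ p b′ y v q b x →
               p :* (b′ :+ y :* v) :+ x :* (b :+ y :+ x :* y) :+ x :* q :* (b′ :+ y :* v)
               := (p :+ x :* q) :* (b′ :+ y :* v) :+ x :* (b :+ y :+ x :* y)) refl
               (p n) b′ y v q b x ⟩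
        (p n + x * q) * (b′ + y * v) + x * t
          ≈⟨ +-congʳ (*-congʳ (trans (+-congˡ (solve 2 (λ q v → q :* v :* q := q :* q :* v) refl q v))
                              (p-quotient n))) ⟩
        (1# + x * p n) * (b′ + y * v) + x * t
          ≈⟨ solve 6 (λ p b′ y v b x →
               (con 1 :+ x :* p) :* (b′ :+ y :* v) :+ x :* (b :+ y :+ x :* y)
               := (b′ :+ x :* b :+ v :* y) :+ (x :* y :+ x :* (p :* (b′ :+ y :* v)) :+ x :* y :* x))
               refl (p n) b′ y v b x ⟩
        -- The last summand is `x * y * x` with `x` read as `q * v`. Thanks to this choice of `x`, y
        -- (1 - x q v) is y (1 - x) (1 + x), which produces the two new terms once 1 - x is
        -- cancelled.
        (b′ + x * b + v * y) + (x * y + x * s′ + x * y * (q * v))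
          ≈⟨ +-congʳ (B-functional x n) ⟩
        (b + x * q * b′ + y) + (x * y + x * s′ + x * y * (q * v))
          ≈⟨ solve 7 (λ p b′ y v q b x →
               (b :+ x :* q :* b′ :+ y) :+ (x :* y :+ x :* (p :* (b′ :+ y :* v)) :+ x :* y :* (q :* v))
               := b :+ y :+ x :* y :+ x :* (p :* (b′ :+ y :* v)) :+ x :* q :* (b′ :+ y :* v)) refl
               (p n) b′ y v q b x ⟩
        t + x * s′ + x * q * (b′ + y * v) ∎)))
      where
      x y v b b′ s′ t : Carrier
      x  = x[ n ]
      v  = q^2* n
      y  = x ^ n
      b  = B x n
      b′ = B (x * q * q) n
      s′ = p n * (b′ + y * v)
      t  = b + y + x * y

      x-suc : x[ suc n ] ≈ x * q * q
      x-suc = solve 2 (λ q v → q :* (q :* q :* v) := q :* v :* q :* q) refl q v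

    -- In the sum for `B` every term but r = 0 carries a factor x, and the term r = 0 is the whole
    -- product. At x = q^(2n+1) this makes `S n` agree with the product through q^(2n).
    B≡∏ : ∀ x s → Σ Carrier λ h → B x (suc s) ≈ ∏ p (suc s) + x * h
    B≡∏ x zero    = 0# , solve 2 (λ p x → p :* (con 0 :+ con 1) := con 1 :* p :+ x :* con 0) refl (p 0) x
    B≡∏ x (suc s) with B≡∏ x s
    ... | h , eq = p (suc s) * (h + x ^ s) , (begin
      p (suc s) * (B x (suc s) + x * x ^ s) ≈⟨ *-congˡ (+-congʳ eq) ⟩
      p (suc s) * (∏ p (suc s) + x * h + x * x ^ s)
        ≈⟨ solve 5 (λ p a x h y → p :* (a :+ x :* h :+ x :* y) := a :* p :+ x :* (p :* (h :+ y))) refl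
             (p (suc s)) (∏ p (suc s)) x h (x ^ s) ⟩
      ∏ p (suc s) * p (suc s) + x * (p (suc s) * (h + x ^ s)) ∎)

open import Data.Bool using (Bool; true; false; if_then_else_)
open import Data.Empty using (⊥; ⊥-elim)
open import Data.Fin using (Fin; zero; suc; toℕ)
open import Data.Fin.Permutation using (↔⇒≡)
open import Data.Fin.Properties using (0↔⊥; 1↔⊤; +↔⊎)
open import Data.Integer as Int using (ℤ; -[1+_])
open import Data.Integer.DivMod using (_%ℕ_)
import Data.Integer.Properties as ℤₚ
open import Data.List using (List; []; _∷_; _++_; replicate)
open import Data.List.Properties using (++-assoc)
open import Data.Maybe using (Maybe; just; nothing)
open import Data.Nat.DivMod
  using ([m+n]%n≡m%n; [m+kn]%n≡m%n; m%n<n; m%n%n≡m%n; %-distribˡ-+; %-distribˡ-*; m*n/n≡m; m*n%n≡0)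
open import Data.Nat.Induction using (<-rec)
open import Data.Nat.Properties using (+-assoc; +-comm; +-suc; +-identityʳ)
open import Data.Product.Function.Dependent.Propositional using (Σ-↔)
open import Data.Product.Function.NonDependent.Propositional using (_×-↔_)
open import Data.Sum using (_⊎_; inj₁; inj₂)
open import Data.Sum.Function.Propositional using (_⊎-↔_)
open import Data.Unit using (⊤; tt)
open import Data.Vec using (Vec; []; _∷_)
open import Function.Bundles using (_↔_; Inverse; mk↔ₛ′)
open import Function.Properties.Inverse using (↔-sym; ↔-trans; ↔-refl)
open import Function.Related.TypeIsomorphisms using (Σ-assoc; Σ-distribʳ-⊎)
open import Relation.Nullary using (Irrelevant)
open import Relation.Binary.PropositionalEquality
  using (_≡_; _≢_; refl; sym; trans; cong; cong₂; subst; isEquivalence; module ≡-Reasoning)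

-- Eisenstein integers

-- ⟨ a , b ⟩ is a + bω, where ω² = -1 - ω.
data Eisenstein : Set where
  ⟨_,_⟩ : ℤ → ℤ → Eisenstein

module _ where
  open import Data.Integer using (+_; _+_; _*_; -_; _-_)
  open import Data.Integer.Tactic.RingSolver using (solve-∀)

  infixl 6 _⊞_
  infixl 7 _⊠_
  _⊞_ _⊠_ : Eisenstein → Eisenstein → Eisenstein
  ⟨ a , b ⟩ ⊞ ⟨ c , d ⟩ = ⟨ a + c , b + d ⟩
  ⟨ a , b ⟩ ⊠ ⟨ c , d ⟩ = ⟨ a * c - b * d , a * d + b * c - b * d ⟩

  ⊟_ : Eisenstein → Eisenstein
  ⊟ ⟨ a , b ⟩ = ⟨ - a , - b ⟩

  ω : Eisenstein
  ω = ⟨ + 0 , + 1 ⟩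

  eisenstein-ring : CommutativeRing 0ℓ 0ℓ
  eisenstein-ring = record
    { Carrier = Eisenstein ; _≈_ = _≡_ ; _+_ = _⊞_ ; _*_ = _⊠_
    ; -_ = ⊟_ ; 0# = ⟨ + 0 , + 0 ⟩ ; 1# = ⟨ + 1 , + 0 ⟩
    ; isCommutativeRing = record
      { isRing = record
        { +-isAbelianGroup = record
          { isGroup = record
            { isMonoid = record
              { isSemigroup = record
                { isMagma = record { isEquivalence = isEquivalence ; ∙-cong = cong₂ _⊞_ }
                ; assoc = λ { ⟨ a , b ⟩ ⟨ c , d ⟩ ⟨ e , f ⟩ →
                    cong₂ ⟨_,_⟩ (ℤₚ.+-assoc a c e) (ℤₚ.+-assoc b d f) }
                }
              ; identity = (λ { ⟨ a , b ⟩ → cong₂ ⟨_,_⟩ (ℤₚ.+-identityˡ a) (ℤₚ.+-identityˡ b) })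
                         , (λ { ⟨ a , b ⟩ → cong₂ ⟨_,_⟩ (ℤₚ.+-identityʳ a) (ℤₚ.+-identityʳ b) })
              }
            ; inverse = (λ { ⟨ a , b ⟩ → cong₂ ⟨_,_⟩ (ℤₚ.+-inverseˡ a) (ℤₚ.+-inverseˡ b) })
                      , (λ { ⟨ a , b ⟩ → cong₂ ⟨_,_⟩ (ℤₚ.+-inverseʳ a) (ℤₚ.+-inverseʳ b) })
            ; ⁻¹-cong = cong ⊟_
            }
          ; comm = λ { ⟨ a , b ⟩ ⟨ c , d ⟩ → cong₂ ⟨_,_⟩ (ℤₚ.+-comm a c) (ℤₚ.+-comm b d) }
          }
        ; *-cong = cong₂ _⊠_
        ; *-assoc = λ { ⟨ a , b ⟩ ⟨ c , d ⟩ ⟨ e , f ⟩ →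
            cong₂ ⟨_,_⟩ (assoc₁ a b c d e f) (assoc₂ a b c d e f) }
        ; *-identity = (λ { ⟨ a , b ⟩ → cong₂ ⟨_,_⟩ (identityˡ₁ a b) (identityˡ₂ a b) })
                     , (λ { ⟨ a , b ⟩ → cong₂ ⟨_,_⟩ (identityʳ₁ a b) (identityʳ₂ a b) })
        ; distrib = (λ { ⟨ a , b ⟩ ⟨ c , d ⟩ ⟨ e , f ⟩ →
                      cong₂ ⟨_,_⟩ (distribˡ₁ a b c d e f) (distribˡ₂ a b c d e f) })
                  , (λ { ⟨ a , b ⟩ ⟨ c , d ⟩ ⟨ e , f ⟩ →
                      cong₂ ⟨_,_⟩ (distribʳ₁ a b c d e f) (distribʳ₂ a b c d e f) })
        }
      ; *-comm = λ { ⟨ a , b ⟩ ⟨ c , d ⟩ → cong₂ ⟨_,_⟩ (comm₁ a b c d) (comm₂ a b c d) }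
      }
    }
    where
    assoc₁ : ∀ a b c d e f → (a * c - b * d) * e - (a * d + b * c - b * d) * f
                           ≡ a * (c * e - d * f) - b * (c * f + d * e - d * f)
    assoc₁ = solve-∀
    assoc₂ : ∀ a b c d e f →
      (a * c - b * d) * f + (a * d + b * c - b * d) * e - (a * d + b * c - b * d) * f
      ≡ a * (c * f + d * e - d * f) + b * (c * e - d * f) - b * (c * f + d * e - d * f)
    assoc₂ = solve-∀
    identityˡ₁ : ∀ a b → + 1 * a - + 0 * b ≡ a
    identityˡ₁ = solve-∀
    identityˡ₂ : ∀ a b → + 1 * b + + 0 * a - + 0 * b ≡ b
    identityˡ₂ = solve-∀
    identityʳ₁ : ∀ a b → a * + 1 - b * + 0 ≡ a
    identityʳ₁ = solve-∀
    identityʳ₂ : ∀ a b → a * + 0 + b * + 1 - b * + 0 ≡ b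
    identityʳ₂ = solve-∀
    distribˡ₁ : ∀ a b c d e f → a * (c + e) - b * (d + f) ≡ (a * c - b * d) + (a * e - b * f)
    distribˡ₁ = solve-∀
    distribˡ₂ : ∀ a b c d e f → a * (d + f) + b * (c + e) - b * (d + f)
                              ≡ (a * d + b * c - b * d) + (a * f + b * e - b * f)
    distribˡ₂ = solve-∀
    distribʳ₁ : ∀ a b c d e f → (c + e) * a - (d + f) * b ≡ (c * a - d * b) + (e * a - f * b)
    distribʳ₁ = solve-∀
    distribʳ₂ : ∀ a b c d e f → (c + e) * b + (d + f) * a - (d + f) * b
                              ≡ (c * b + d * a - d * b) + (e * b + f * a - f * b)
    distribʳ₂ = solve-∀
    comm₁ : ∀ a b c d → a * c - b * d ≡ c * a - d * b
    comm₁ = solve-∀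
    comm₂ : ∀ a b c d → a * d + b * c - b * d ≡ c * b + d * a - d * b
    comm₂ = solve-∀

  -- c₀ + c₁ω² + c₂ω, as c j will count the objects of rank -j modulo 3.
  evaluate : (ℕ → ℕ) → Eisenstein
  evaluate c = ⟨ + c 0 - + c 1 , + c 2 - + c 1 ⟩

  evaluate-+ : ∀ a b → evaluate (λ j → a j ℕ.+ b j) ≡ evaluate a ⊞ evaluate b
  evaluate-+ a b = cong₂ ⟨_,_⟩ (lemma (a 0) (b 0)) (lemma (a 2) (b 2))
    where
    regroup : ∀ x y u v → (x + y) - (u + v) ≡ (x - u) + (y - v)
    regroup = solve-∀
    lemma : ∀ x y → + (x ℕ.+ y) - + (a 1 ℕ.+ b 1) ≡ (+ x - + a 1) + (+ y - + b 1)
    lemma x y = trans (cong₂ _-_ (ℤₚ.pos-+ x y) (ℤₚ.pos-+ (a 1) (b 1)))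
                      (regroup (+ x) (+ y) (+ a 1) (+ b 1))

  -- Multiplying by ω permutes 1, ω², ω cyclically, and so does moving j by one, as `c` has period
  -- 3.
  evaluate-suc : ∀ c → c 3 ≡ c 0 → evaluate (λ j → c (suc j)) ≡ ω ⊠ evaluate c
  evaluate-suc c c₃≡c₀ rewrite c₃≡c₀ =
    cong₂ ⟨_,_⟩ (first (+ c 0) (+ c 1) (+ c 2)) (second (+ c 0) (+ c 1) (+ c 2))
    where
    first : ∀ x y z → y - z ≡ + 0 * (x - y) - + 1 * (z - y)
    first = solve-∀
    second : ∀ x y z → x - z ≡ + 0 * (z - y) + + 1 * (x - y) - + 1 * (z - y)
    second = solve-∀

  re im : Eisenstein → ℤ
  re ⟨ a , b ⟩ = a
  im ⟨ a , b ⟩ = b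

  -- 1 and ω are independent over the integers, so 1 + ω + ω² = 0 is, up to multiples, the only
  -- relation among the three powers.
  evaluate≡0 : ∀ c → evaluate c ≡ ⟨ + 0 , + 0 ⟩ → c 0 ≡ c 1 × c 2 ≡ c 1
  evaluate≡0 c eq = ℤₚ.+-injective (ℤₚ.i-j≡0⇒i≡j (+ c 0) (+ c 1) (cong re eq))
                  , ℤₚ.+-injective (ℤₚ.i-j≡0⇒i≡j (+ c 2) (+ c 1) (cong im eq))

private
  variable
    A B C : Set

open import Data.Nat using (_+_; _*_; _∸_; _/_; _%_; _<_; _≤_; z≤n; s≤s; _≡ᵇ_)
open import Data.Nat.Tactic.RingSolver using (solve-∀)
open CommutativeRing eisenstein-ring using (0#; 1#)

-- Counting by weight and rank

ω^ : ℕ → Eisenstein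
ω^ zero    = 1#
ω^ (suc e) = ω ⊠ ω^ e

irrelevant-↔ : {P Q : Set} → Irrelevant P → Irrelevant Q → (P → Q) → (Q → P) → P ↔ Q
irrelevant-↔ P-irr Q-irr f g = mk↔ₛ′ f g (λ _ → Q-irr _ _) (λ _ → P-irr _ _)

-- Fixing rank + j ≡ 0 rather than the rank makes adding e to the rank a shift of j by e.
record Fibre {A : Set} (w ρ : A → ℕ) (n j : ℕ) : Set where
  constructor fibre
  field
    element : A
    level   : w element ≡ n × (ρ element + j) % 3 ≡ 0

Fibre-Σ : ∀ {w ρ : A → ℕ} {n j} → Fibre w ρ n j ↔ Σ A λ a → w a ≡ n × (ρ a + j) % 3 ≡ 0
Fibre-Σ = mk↔ₛ′ (λ (fibre a l) → a , l) (λ (a , l) → fibre a l) (λ _ → refl) (λ _ → refl)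

Fibre-irrelevant : ∀ {x y u v : ℕ} → Irrelevant (x ≡ y × u ≡ v)
Fibre-irrelevant (p , q) (p′ , q′) = cong₂ _,_ (ℕₚ.≡-irrelevant p p′) (ℕₚ.≡-irrelevant q q′)

Fibre-↔ : {w ρ : A → ℕ} {w′ ρ′ : B → ℕ} {n n′ j j′ : ℕ} (e : A ↔ B) →
  (∀ a → w a ≡ n → w′ (Inverse.to e a) ≡ n′) → (∀ a → w′ (Inverse.to e a) ≡ n′ → w a ≡ n) →
  (∀ a → (ρ a + j) % 3 ≡ (ρ′ (Inverse.to e a) + j′) % 3) →
  Fibre w ρ n j ↔ Fibre w′ ρ′ n′ j′
Fibre-↔ e f g r = ↔-trans Fibre-Σ (↔-trans
  (Σ-↔ e λ {a} → irrelevant-↔ Fibre-irrelevant Fibre-irrelevant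
    (λ (p , q) → f a p , trans (sym (r a)) q) (λ (p , q) → g a p , trans (r a) q))
  (↔-sym Fibre-Σ))

Fibre-cong : {w ρ : A → ℕ} {w′ ρ′ : B → ℕ} (e : A ↔ B) → (∀ a → w a ≡ w′ (Inverse.to e a)) →
  (∀ a → ρ a ≡ ρ′ (Inverse.to e a)) → ∀ n j → Fibre w ρ n j ↔ Fibre w′ ρ′ n j
Fibre-cong e p r n j = Fibre-↔ e (λ a → trans (sym (p a))) (λ a → trans (p a))
  (λ a → cong (λ x → (x + j) % 3) (r a))

Fibre-period : ∀ {w ρ : A → ℕ} n j → Fibre w ρ n (3 + j) ↔ Fibre w ρ n j
Fibre-period {ρ = ρ} n j = Fibre-↔ ↔-refl (λ _ p → p) (λ _ p → p) λ a →
  trans (cong (_% 3) (trans (cong (ρ a +_) (+-comm 3 j)) (sym (+-assoc (ρ a) j 3))))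
        ([m+n]%n≡m%n (ρ a + j) 3)

Fibre-shift-rank : ∀ {w ρ : A → ℕ} e n j → Fibre w (λ a → e + ρ a) n j ↔ Fibre w ρ n (j + e)
Fibre-shift-rank {ρ = ρ} e n j = Fibre-↔ ↔-refl (λ _ p → p) (λ _ p → p) λ a → cong (_% 3)
  (trans (+-assoc e (ρ a) j) (trans (+-comm e (ρ a + j)) (+-assoc (ρ a) j e)))

-- No object weighs less than k, hence the filler ⊥. The same `shift` with fillers 0 and `0#` acts
-- on counts and on coefficients, where it is multiplication by q^k.
Fibre-shift-weight : ∀ {w ρ : A → ℕ} k n j →
  Fibre (λ a → k + w a) ρ n j ↔ shift ⊥ k (λ m → Fibre w ρ m j) n
Fibre-shift-weight zero    n       j = ↔-refl
Fibre-shift-weight (suc k) zero    j =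
  mk↔ₛ′ (λ { (fibre _ (() , _)) }) (λ ()) (λ ()) (λ { (fibre _ (() , _)) })
Fibre-shift-weight (suc k) (suc n) j = ↔-trans
  (Fibre-↔ ↔-refl (λ _ → ℕₚ.suc-injective) (λ _ → cong suc) (λ _ → refl))
  (Fibre-shift-weight k n j)

shift-↔ : ∀ {F G : ℕ → Set} → (∀ n → F n ↔ G n) → ∀ k n → shift ⊥ k F n ↔ shift ⊥ k G n
shift-↔ e zero    n       = e n
shift-↔ e (suc k) zero    = ↔-refl
shift-↔ e (suc k) (suc n) = shift-↔ e k n

shift-Fin : ∀ (c : ℕ → ℕ) k n → shift ⊥ k (λ m → Fin (c m)) n ↔ Fin (shift 0 k c n)
shift-Fin c zero    n       = ↔-refl
shift-Fin c (suc k) zero    = ↔-sym 0↔⊥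
shift-Fin c (suc k) (suc n) = shift-Fin c k n

-- The set-level form of a series equation B = A + ω^e q^k C. With C = A it yields the factor 1 +
-- ω^e q^k, with C = B the recursion of a geometric series.
Fibre-⊎ : ∀ {wA ρA : A → ℕ} {wB ρB : B → ℕ} {wC ρC : C → ℕ} (k e : ℕ) (i : (A ⊎ C) ↔ B) →
  (∀ a → wA a ≡ wB (Inverse.to i (inj₁ a))) → (∀ c → k + wC c ≡ wB (Inverse.to i (inj₂ c))) →
  (∀ a → ρA a ≡ ρB (Inverse.to i (inj₁ a))) → (∀ c → e + ρC c ≡ ρB (Inverse.to i (inj₂ c))) →
  ∀ n j → Fibre wB ρB n j ↔ (Fibre wA ρA n j ⊎ shift ⊥ k (λ m → Fibre wC ρC m (j + e)) n)
Fibre-⊎ {A} {B} {C} {wA} {ρA} {wB} {ρB} {wC} {ρC} k e i p₁ p₂ r₁ r₂ n j =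
  ↔-trans (↔-sym (Fibre-cong i p r n j))
  (↔-trans split
  (↔-refl ⊎-↔ ↔-trans (Fibre-shift-weight k n j) (shift-↔ (λ m → Fibre-shift-rank e m j) k n)))
  where
  split : ∀ {w ρ : A ⊎ C → ℕ} →
    Fibre w ρ n j ↔ (Fibre (λ a → w (inj₁ a)) (λ a → ρ (inj₁ a)) n j ⊎
                     Fibre (λ c → w (inj₂ c)) (λ c → ρ (inj₂ c)) n j)
  split = ↔-trans Fibre-Σ (↔-trans Σ-distribʳ-⊎ (↔-sym Fibre-Σ ⊎-↔ ↔-sym Fibre-Σ))
  w ρ : A ⊎ C → ℕ
  w (inj₁ a) = wA a
  w (inj₂ c) = k + wC c
  ρ (inj₁ a) = ρA a
  ρ (inj₂ c) = e + ρC c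
  p : ∀ x → w x ≡ wB (Inverse.to i x)
  p (inj₁ a) = p₁ a
  p (inj₂ c) = p₂ c
  r : ∀ x → ρ x ≡ ρB (Inverse.to i x)
  r (inj₁ a) = r₁ a
  r (inj₂ c) = r₂ c

Counts : (w ρ : A → ℕ) → (ℕ → ℕ → ℕ) → Set
Counts w ρ c = ∀ n j → Fibre w ρ n j ↔ Fin (c n j)

Counts-period : ∀ {w ρ : A → ℕ} {c} → Counts w ρ c → ∀ n j → c n (3 + j) ≡ c n j
Counts-period F n j = ↔⇒≡ (↔-trans (↔-sym (F n (3 + j))) (↔-trans (Fibre-period n j) (F n j)))

evaluate-+-period : ∀ e c → (∀ j → c (3 + j) ≡ c j) → evaluate (λ j → c (j + e)) ≡ ω^ e ⊠ evaluate c
evaluate-+-period zero c per = trans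
  (cong₂ ⟨_,_⟩ (cong₂ Int._-_ (e0 0) (e0 1)) (cong₂ Int._-_ (e0 2) (e0 1)))
  (sym (CommutativeRing.*-identityˡ eisenstein-ring (evaluate c)))
  where
  e0 : ∀ j → Int.+ c (j + 0) ≡ Int.+ c j
  e0 j = cong (λ i → Int.+ c i) (ℕₚ.+-identityʳ j)
evaluate-+-period (suc e) c per = trans (evaluate-suc (λ j → c (j + e)) (per e))
  (trans (cong (ω ⊠_) (evaluate-+-period e c per))
  (sym (CommutativeRing.*-assoc eisenstein-ring ω (ω^ e) (evaluate c))))

generating : (ℕ → ℕ → ℕ) → ℕ → Eisenstein
generating c n = evaluate (c n)

evaluate-shift : ∀ e k c → (∀ n j → c n (3 + j) ≡ c n j) → ∀ n →
  evaluate (λ j → shift 0 k (λ m → c m (j + e)) n) ≡ ω^ e ⊠ shift 0# k (generating c) n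
evaluate-shift e zero    c per n       = evaluate-+-period e (c n) (per n)
evaluate-shift e (suc k) c per zero    = sym (CommutativeRing.zeroʳ eisenstein-ring (ω^ e))
evaluate-shift e (suc k) c per (suc n) = evaluate-shift e k c per n

module _ {wA ρA : A → ℕ} {cA} (FA : Counts wA ρA cA) (k e : ℕ) where

  ⊎-Fin : ∀ {wC ρC : C → ℕ} {cC} → Counts wC ρC cC → ∀ n j →
    (Fibre wA ρA n j ⊎ shift ⊥ k (λ m → Fibre wC ρC m (j + e)) n) ↔
    Fin (cA n j + shift 0 k (λ m → cC m (j + e)) n)
  ⊎-Fin FC n j = ↔-trans
    (FA n j ⊎-↔ ↔-trans (shift-↔ (λ m → FC m (j + e)) k n) (shift-Fin _ k n)) (↔-sym +↔⊎)

  -- Only bijections with `Fin` are compared, so it does not matter how `cB` was obtained. In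
  -- particular `cB` and `cC` may be the same count.
  generating-⊎ : ∀ {wB ρB : B → ℕ} {wC ρC : C → ℕ} {cB cC} →
    (∀ n j → Fibre wB ρB n j ↔ (Fibre wA ρA n j ⊎ shift ⊥ k (λ m → Fibre wC ρC m (j + e)) n)) →
    Counts wB ρB cB → Counts wC ρC cC → ∀ n →
    generating cB n ≡ generating cA n ⊞ (ω^ e ⊠ shift 0# k (generating cC) n)
  generating-⊎ {cB = cB} {cC = cC} i FB FC n = trans
    (cong₂ ⟨_,_⟩ (cong₂ Int._-_ (card 0) (card 1)) (cong₂ Int._-_ (card 2) (card 1)))
    (trans (evaluate-+ (cA n) (λ j → shift 0 k (λ m → cC m (j + e)) n))
           (cong (generating cA n ⊞_) (evaluate-shift e k cC (Counts-period FC) n)))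
    where
    card : ∀ j → Int.+ cB n j ≡ Int.+ (cA n j + shift 0 k (λ m → cC m (j + e)) n)
    card j = cong Int.+_ (↔⇒≡ (↔-trans (↔-sym (FB n j)) (↔-trans (i n j) (⊎-Fin FC n j))))

  ⊎-Bool : (A ⊎ A) ↔ (Bool × A)
  ⊎-Bool = mk↔ₛ′ (λ { (inj₁ a) → false , a ; (inj₂ a) → true , a })
                 (λ { (false , a) → inj₁ a ; (true , a) → inj₂ a })
                 (λ { (false , a) → refl ; (true , a) → refl })
                 (λ { (inj₁ a) → refl ; (inj₂ a) → refl })

  w-Bool ρ-Bool : Bool × A → ℕ
  w-Bool (b , a) = (if b then k else 0) + wA a
  ρ-Bool (b , a) = (if b then e else 0) + ρA a

  opaque
    count-Bool : Σ _ λ c → Counts w-Bool ρ-Bool c ×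
      (∀ n → generating c n ≡ generating cA n ⊞ (ω^ e ⊠ shift 0# k (generating cA) n))
    count-Bool = c , F , generating-⊎ i F FA
      where
      i : ∀ n j → Fibre w-Bool ρ-Bool n j ↔ (Fibre wA ρA n j ⊎ shift ⊥ k (λ m → Fibre wA ρA m (j + e)) n)
      i = Fibre-⊎ k e ⊎-Bool (λ _ → refl) (λ _ → refl) (λ _ → refl) (λ _ → refl)
      c : ℕ → ℕ → ℕ
      c n j = cA n j + shift 0 k (λ m → cA m (j + e)) n
      F : Counts w-Bool ρ-Bool c
      F n j = ↔-trans (i n j) (⊎-Fin FA n j)

shift-finite : ∀ {F : ℕ → Set} k n → (∀ m → m + k ≡ n → Σ ℕ λ c → F m ↔ Fin c) →
  Σ ℕ λ c → shift ⊥ k F n ↔ Fin c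
shift-finite zero    n       f = f n (ℕₚ.+-identityʳ n)
shift-finite (suc k) zero    f = 0 , ↔-sym 0↔⊥
shift-finite (suc k) (suc n) f = shift-finite k n λ m p → f m (trans (+-suc m k) (cong suc p))

module _ {wA ρA : A → ℕ} {cA} (FA : Counts wA ρA cA) (k e : ℕ) where

  ⊎-ℕ : (A ⊎ (ℕ × A)) ↔ (ℕ × A)
  ⊎-ℕ = mk↔ₛ′ (λ { (inj₁ a) → zero , a ; (inj₂ (t , a)) → suc t , a })
              (λ { (zero , a) → inj₁ a ; (suc t , a) → inj₂ (t , a) })
              (λ { (zero , a) → refl ; (suc t , a) → refl })
              (λ { (inj₁ a) → refl ; (inj₂ (t , a)) → refl })

  w-ℕ ρ-ℕ : ℕ × A → ℕ
  w-ℕ (t , a) = t * suc k + wA a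
  ρ-ℕ (t , a) = t * e + ρA a

  -- Either there is no copy, or one copy is removed and the same kind of object remains.
  Fibre-ℕ : ∀ n j → Fibre w-ℕ ρ-ℕ n j ↔
    (Fibre wA ρA n j ⊎ shift ⊥ (suc k) (λ m → Fibre w-ℕ ρ-ℕ m (j + e)) n)
  Fibre-ℕ = Fibre-⊎ (suc k) e ⊎-ℕ
    (λ _ → refl) (λ (t , a) → sym (+-assoc (suc k) (t * suc k) (wA a)))
    (λ _ → refl) (λ (t , a) → sym (+-assoc e (t * e) (ρA a)))

  opaque
    count-ℕ : Σ _ λ c → Counts w-ℕ ρ-ℕ c ×
      (∀ n → generating c n ≡ generating cA n ⊞ (ω^ e ⊠ shift 0# (suc k) (generating c) n))
    count-ℕ = (λ n j → proj₁ (finite n j)) , (λ n j → proj₂ (finite n j)) ,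
      generating-⊎ FA (suc k) e Fibre-ℕ (λ n j → proj₂ (finite n j)) (λ n j → proj₂ (finite n j))
      where
      finite : ∀ n j → Σ ℕ λ c → Fibre w-ℕ ρ-ℕ n j ↔ Fin c
      -- Removing a copy lowers the weight by `suc k`, which is positive, but moves j, so the
      -- recursion on n treats all j at once.
      finite = <-rec _ λ n rec j →
        let s , S = shift-finite (suc k) n λ m p →
                      rec (subst (m <_) p (ℕₚ.m<m+n m (s≤s Data.Nat.z≤n))) (j + e)
        in cA n j + s , ↔-trans (Fibre-ℕ n j) (↔-trans (FA n j ⊎-↔ S) (↔-sym +↔⊎))

-- Multiplicities with designated positions

-- The pair (m - i, i): choosing one of m + 1 positions amounts to writing m as an ordered sum.
split-Fin : ∀ m → Fin (suc m) → ℕ × ℕ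
split-Fin m       zero    = m , 0
split-Fin (suc m) (suc i) = proj₁ (split-Fin m i) , suc (proj₂ (split-Fin m i))

join-Fin : ℕ → ℕ → Σ ℕ λ m → Fin (suc m)
join-Fin a zero    = a , zero
join-Fin a (suc j) = suc (proj₁ (join-Fin a j)) , suc (proj₂ (join-Fin a j))

split-join : ∀ a j → split-Fin (proj₁ (join-Fin a j)) (proj₂ (join-Fin a j)) ≡ (a , j)
split-join a zero    = refl
split-join a (suc j) = cong (λ (b , i) → b , suc i) (split-join a j)

join-split : ∀ m i → join-Fin (proj₁ (split-Fin m i)) (proj₂ (split-Fin m i)) ≡ (m , i)
join-split m       zero    = refl
join-split (suc m) (suc i) = cong (λ (n , l) → suc n , suc l) (join-split m i)

split-Fin-sum : ∀ m i → m ≡ proj₁ (split-Fin m i) + proj₂ (split-Fin m i)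
split-Fin-sum m       zero    = sym (+-identityʳ m)
split-Fin-sum (suc m) (suc i) = trans (cong suc (split-Fin-sum m i)) (sym (+-suc _ _))

split-Fin-toℕ : ∀ m i → toℕ i ≡ proj₂ (split-Fin m i)
split-Fin-toℕ m       zero    = refl
split-Fin-toℕ (suc m) (suc i) = cong suc (split-Fin-toℕ m i)

split-Fin-∸ : ∀ m i → m ∸ toℕ i ≡ proj₁ (split-Fin m i)
split-Fin-∸ m       zero    = refl
split-Fin-∸ (suc m) (suc i) = split-Fin-∸ m i

-- (a , g): a copies go to α; none go to γ if g = nothing, and j + 2 if g = just j.
slot-split : Slot → ℕ × Maybe ℕ
slot-split (zero        , _)     = 0 , nothing
slot-split (suc m       , zero)  = suc m , nothing
slot-split (suc (suc m) , suc i) = proj₁ (split-Fin m i) , just (proj₂ (split-Fin m i))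

slot-join : ℕ × Maybe ℕ → Slot
slot-join (zero  , nothing) = 0 , tt
slot-join (suc a , nothing) = suc a , zero
slot-join (a     , just j)  = suc (suc (proj₁ (join-Fin a j))) , suc (proj₂ (join-Fin a j))

-- The two multiplicities produced by Δ at a part size are subject to no joint condition; this is
-- why the contribution of the size is a product.
slot-↔ : Slot ↔ (ℕ × Maybe ℕ)
slot-↔ = mk↔ₛ′ slot-split slot-join split∘join join∘split
  where
  split∘join : ∀ x → slot-split (slot-join x) ≡ x
  split∘join (zero  , nothing) = refl
  split∘join (suc a , nothing) = refl
  split∘join (zero  , just j)  = cong (λ (b , i) → b , just i) (split-join zero j)
  split∘join (suc a , just j)  = cong (λ (b , i) → b , just i) (split-join (suc a) j)
  join-just : ∀ a j → slot-join (a , just j)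
            ≡ (suc (suc (proj₁ (join-Fin a j))) , suc (proj₂ (join-Fin a j)))
  join-just zero    j = refl
  join-just (suc a) j = refl
  join∘split : ∀ s → slot-join (slot-split s) ≡ s
  join∘split (zero        , tt)    = refl
  join∘split (suc m       , zero)  = refl
  join∘split (suc (suc m) , suc i) = trans (join-just (proj₁ (split-Fin m i)) _)
    (cong (λ (n , l) → suc (suc n) , suc l) (join-split m i))

γ-size : Maybe ℕ → ℕ
γ-size nothing  = 0
γ-size (just j) = 2 + j

γ-list : ℕ → Maybe ℕ → List (ℕ × ℕ)
γ-list k nothing  = []
γ-list k (just j) = (k , 2 + j) ∷ []

slot-size : ∀ s → proj₁ s ≡ proj₁ (slot-split s) + γ-size (proj₂ (slot-split s))
slot-size (zero        , _)     = refl
slot-size (suc m       , zero)  = sym (+-identityʳ (suc m))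
slot-size (suc (suc m) , suc i) = trans (cong (λ x → suc (suc x)) (split-Fin-sum m i))
  (sym (trans (+-suc _ _) (cong suc (+-suc _ _))))

slotSplit-split : ∀ k s → slotSplit k s ≡
  (replicate (proj₁ (slot-split s)) k , γ-list k (proj₂ (slot-split s)))
slotSplit-split k (zero        , _)     = refl
slotSplit-split k (suc m       , zero)  = refl
slotSplit-split k (suc (suc m) , suc i) = cong₂ (λ a j → replicate a k , (k , 2 + j) ∷ [])
  (split-Fin-∸ m i) (split-Fin-toℕ m i)

-- The multiplicity is 2t + 3b. The only number not of this form is 1, the one that the coding by
-- `Maybe ℕ` leaves out.
γ-split : Maybe ℕ → ℕ × Bool
γ-split nothing              = 0 , false
γ-split (just zero)          = 1 , false
γ-split (just (suc zero))    = 0 , true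
γ-split (just (suc (suc j))) = suc (proj₁ (γ-split (just j))) , proj₂ (γ-split (just j))

γ-join : ℕ × Bool → Maybe ℕ
γ-join (zero  , false) = nothing
γ-join (suc t , false) = just (t * 2)
γ-join (t     , true)  = just (suc (t * 2))

γ-↔ : Maybe ℕ ↔ (ℕ × Bool)
γ-↔ = mk↔ₛ′ γ-split γ-join split∘join join∘split
  where
  even : ∀ t → γ-split (just (t * 2)) ≡ (suc t , false)
  even zero    = refl
  even (suc t) = cong (λ (u , b) → suc u , b) (even t)
  odd : ∀ t → γ-split (just (suc (t * 2))) ≡ (t , true)
  odd zero    = refl
  odd (suc t) = cong (λ (u , b) → suc u , b) (odd t)
  split∘join : ∀ x → γ-split (γ-join x) ≡ x
  split∘join (zero  , false) = refl
  split∘join (suc t , false) = even t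
  split∘join (zero  , true)  = refl
  split∘join (suc t , true)  = odd (suc t)
  step : ∀ x j → γ-join x ≡ just j → γ-join (suc (proj₁ x) , proj₂ x) ≡ just (suc (suc j))
  step (suc t , false) _ refl = refl
  step (zero  , true)  _ refl = refl
  step (suc t , true)  _ refl = refl
  join∘split : ∀ g → γ-join (γ-split g) ≡ g
  join∘split nothing              = refl
  join∘split (just zero)          = refl
  join∘split (just (suc zero))    = refl
  join∘split (just (suc (suc j))) = step (γ-split (just j)) j (join∘split (just j))

bit : Bool → ℕ
bit b = if b then 1 else 0

γ-size-split : ∀ g → γ-size g ≡ proj₁ (γ-split g) * 2 + bit (proj₂ (γ-split g)) * 3
γ-size-split nothing              = refl
γ-size-split (just zero)          = refl
γ-size-split (just (suc zero))    = refl
γ-size-split (just (suc (suc j))) = cong (2 +_) (γ-size-split (just j))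

sPart-+2 : ∀ m → sPart (2 + m) ≡ sPart m
sPart-+2 m = cong (λ r → if r ≡ᵇ 1 then 3 else 0)
  (trans (cong (_% 2) (+-comm 2 m)) ([m+n]%n≡m%n m 2))

sPart-t+3b : ∀ t b → sPart (t * 2 + bit b * 3) ≡ bit b * 3
sPart-t+3b zero    false = refl
sPart-t+3b zero    true  = refl
sPart-t+3b (suc t) b     = trans (sPart-+2 (t * 2 + bit b * 3)) (sPart-t+3b t b)

module _ (g : Maybe ℕ) where
  private
    t = proj₁ (γ-split g)
    b = proj₂ (γ-split g)

  sPart-γ : sPart (γ-size g) ≡ bit b * 3
  sPart-γ = trans (cong sPart (γ-size-split g)) (sPart-t+3b t b)

  sPart-γ/3 : sPart (γ-size g) / 3 ≡ bit b
  sPart-γ/3 = trans (cong (_/ 3) sPart-γ) (m*n/n≡m (bit b) 3)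

  tPart-γ/2 : tPart (γ-size g) / 2 ≡ t
  tPart-γ/2 = trans
    (cong (_/ 2) (trans (cong₂ _∸_ (γ-size-split g) sPart-γ) (ℕₚ.m+n∸n≡m (t * 2) (bit b * 3))))
    (m*n/n≡m t 2)

-- Parity of parts and the rank

even? : ℕ → ℕ
even? k = if (k % 2 ≡ᵇ 0) then 1 else 0

even?-+2 : ∀ k → even? (2 + k) ≡ even? k
even?-+2 k = cong (λ r → if r ≡ᵇ 0 then 1 else 0)
  (trans (cong (_% 2) (+-comm 2 k)) ([m+n]%n≡m%n k 2))

even?-+2* : ∀ m k → even? (m * 2 + k) ≡ even? k
even?-+2* zero    k = refl
even?-+2* (suc m) k = trans (even?-+2 (m * 2 + k)) (even?-+2* m k)

even?-2* : ∀ k → even? (2 * k) ≡ 1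
even?-2* k = trans (cong even? (lemma k)) (even?-+2* k 0)
  where
  lemma : ∀ k → 2 * k ≡ k * 2 + 0
  lemma = solve-∀

even?-3* : ∀ k → even? (3 * k) ≡ even? k
even?-3* k = trans (cong even? (lemma k)) (even?-+2* k k)
  where
  lemma : ∀ k → 3 * k ≡ k * 2 + k
  lemma = solve-∀

evenParts-++ : ∀ xs ys → evenParts (xs ++ ys) ≡ evenParts xs + evenParts ys
evenParts-++ []       ys = refl
evenParts-++ (x ∷ xs) ys = trans (cong (even? x +_) (evenParts-++ xs ys)) (sym (+-assoc (even? x) _ _))

evenParts-replicate : ∀ n k → evenParts (replicate n k) ≡ n * even? k
evenParts-replicate zero    k = refl
evenParts-replicate (suc n) k = cong (even? k +_) (evenParts-replicate n k)

Φ-++ : ∀ γ δ → Φ (γ ++ δ) ≡ Φ γ ++ Φ δ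
Φ-++ []            δ = refl
Φ-++ ((k , m) ∷ γ) δ = trans (cong (λ xs → twos ++ threes ++ xs) (Φ-++ γ δ))
  (trans (cong (twos ++_) (sym (++-assoc threes (Φ γ) (Φ δ))))
  (sym (++-assoc twos (threes ++ Φ γ) (Φ δ))))
  where
  twos threes : List ℕ
  twos   = replicate (tPart m / 2) (2 * k)
  threes = replicate (sPart m / 3) (3 * k)

-- A part 2k is even whatever k is, while 3k has the parity of k. Hence pairs always lower the rank,
-- and the triple does so only for even k.
evenParts-Φ-γ : ∀ k g → evenParts (Φ (γ-list k g))
              ≡ proj₁ (γ-split g) + bit (proj₂ (γ-split g)) * even? k
evenParts-Φ-γ k nothing  = refl
evenParts-Φ-γ k (just j) = begin
  evenParts (twos ++ threes ++ []) ≡⟨ evenParts-++ twos _ ⟩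
  evenParts twos + evenParts (threes ++ []) ≡⟨ cong (evenParts twos +_) (evenParts-++ threes []) ⟩
  evenParts twos + (evenParts threes + 0)
    ≡⟨ cong₂ (λ x y → x + (y + 0)) (evenParts-replicate T (2 * k)) (evenParts-replicate S (3 * k)) ⟩
  T * even? (2 * k) + (S * even? (3 * k) + 0)
    ≡⟨ cong₂ (λ x y → T * x + (S * y + 0)) (even?-2* k) (even?-3* k) ⟩
  T * 1 + (S * even? k + 0)
    ≡⟨ cong₂ _+_ (ℕₚ.*-identityʳ T) (+-identityʳ _) ⟩
  T + S * even? k ≡⟨ cong₂ (λ x y → x + y * even? k) (tPart-γ/2 (just j)) (sPart-γ/3 (just j)) ⟩
  proj₁ (γ-split (just j)) + bit (proj₂ (γ-split (just j))) * even? k ∎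
  where
  open ≡-Reasoning
  T S : ℕ
  T = tPart (2 + j) / 2
  S = sPart (2 + j) / 3
  twos threes : List ℕ
  twos   = replicate T (2 * k)
  threes = replicate S (3 * k)

-- Congruent modulo 3 to l_e(α) - l_e(β).
rankFrom : ℕ → ∀ {n} → Vec Slot n → ℕ
rankFrom k v = evenParts (proj₁ (splitFrom k v)) + 2 * evenParts (Φ (proj₂ (splitFrom k v)))

-- The coordinates are the copies in α, the pairs in γ and the triple in γ. Each is split off by one
-- use of `HasSeries-ℕ` or `HasSeries-Bool`, hence the nesting to the right.
vec-↔ : ∀ n → Vec Slot (suc n) ↔ (ℕ × (ℕ × (Bool × Vec Slot n)))
vec-↔ n = ↔-trans uncons (↔-trans (slot-↔ ×-↔ ↔-refl) (↔-trans (((↔-refl ×-↔ γ-↔) ×-↔ ↔-refl)) assoc))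
  where
  uncons : Vec Slot (suc n) ↔ (Slot × Vec Slot n)
  uncons = mk↔ₛ′ (λ { (s ∷ v) → s , v }) (λ (s , v) → s ∷ v) (λ _ → refl) (λ { (s ∷ v) → refl })
  assoc : ((ℕ × (ℕ × Bool)) × Vec Slot n) ↔ (ℕ × (ℕ × (Bool × Vec Slot n)))
  assoc = mk↔ₛ′ (λ ((a , (t , b)) , v) → a , (t , (b , v)))
                (λ (a , (t , (b , v))) → (a , (t , b)) , v) (λ _ → refl) (λ _ → refl)

module _ (k : ℕ) {n : ℕ} where

  code-weight code-rank : ℕ × (ℕ × (Bool × Vec Slot n)) → ℕ
  code-weight (a , (t , (b , v))) =
    a * k + (t * (2 * k) + ((if b then 3 * k else 0) + weightFrom (suc k) v))
  code-rank (a , (t , (b , v))) =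
    a * even? k + (t * 2 + ((if b then 2 * even? k else 0) + rankFrom (suc k) v))

  bit-* : ∀ b x → bit b * x ≡ (if b then x else 0)
  bit-* false x = refl
  bit-* true  x = +-identityʳ x

  weightFrom-code : (v : Vec Slot (suc n)) → weightFrom k v ≡ code-weight (Inverse.to (vec-↔ n) v)
  weightFrom-code (s@(m , _) ∷ v) = begin
    k * m + W ≡⟨ cong (λ x → k * x + W) (trans (slot-size s) (cong (a +_) (γ-size-split g))) ⟩
    k * (a + (t * 2 + bit b * 3)) + W ≡⟨ lemma k a t (bit b) W ⟩
    a * k + (t * (2 * k) + (bit b * (3 * k) + W))
      ≡⟨ cong (λ x → a * k + (t * (2 * k) + (x + W))) (bit-* b (3 * k)) ⟩
    a * k + (t * (2 * k) + ((if b then 3 * k else 0) + W)) ∎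
    where
    open ≡-Reasoning
    a = proj₁ (slot-split s)
    g = proj₂ (slot-split s)
    t = proj₁ (γ-split g)
    b = proj₂ (γ-split g)
    W = weightFrom (suc k) v
    lemma : ∀ k a t b W → k * (a + (t * 2 + b * 3)) + W ≡ a * k + (t * (2 * k) + (b * (3 * k) + W))
    lemma = solve-∀

  rankFrom-code : (v : Vec Slot (suc n)) → rankFrom k v ≡ code-rank (Inverse.to (vec-↔ n) v)
  rankFrom-code (s ∷ v) = begin
    evenParts (proj₁ (slotSplit k s) ++ α) + 2 * evenParts (Φ (proj₂ (slotSplit k s) ++ γ))
      ≡⟨ cong (λ x → evenParts (proj₁ x ++ α) + 2 * evenParts (Φ (proj₂ x ++ γ))) (slotSplit-split k s) ⟩
    evenParts (replicate a k ++ α) + 2 * evenParts (Φ (γ-list k g ++ γ))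
      ≡⟨ cong₂ (λ x y → x + 2 * y)
           (trans (evenParts-++ (replicate a k) α) (cong (_+ evenParts α) (evenParts-replicate a k)))
           (trans (cong evenParts (Φ-++ (γ-list k g) γ))
           (trans (evenParts-++ (Φ (γ-list k g)) (Φ γ)) (cong (_+ evenParts (Φ γ)) (evenParts-Φ-γ k g)))) ⟩
    (a * e + evenParts α) + 2 * ((t + bit b * e) + evenParts (Φ γ))
      ≡⟨ lemma a e (evenParts α) t (bit b) (evenParts (Φ γ)) ⟩
    a * e + (t * 2 + (bit b * (2 * e) + (evenParts α + 2 * evenParts (Φ γ))))
      ≡⟨ cong (λ x → a * e + (t * 2 + (x + rankFrom (suc k) v))) (bit-* b (2 * e)) ⟩
    a * e + (t * 2 + ((if b then 2 * e else 0) + rankFrom (suc k) v)) ∎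
    where
    open ≡-Reasoning
    α = proj₁ (splitFrom (suc k) v)
    γ = proj₂ (splitFrom (suc k) v)
    e = even? k
    a = proj₁ (slot-split s)
    g = proj₂ (slot-split s)
    t = proj₁ (γ-split g)
    b = proj₂ (γ-split g)
    lemma : ∀ a e x t b y → (a * e + x) + 2 * ((t + b * e) + y)
                          ≡ a * e + (t * 2 + (b * (2 * e) + (x + 2 * y)))
    lemma = solve-∀

-- The integer rank modulo 3

-[1+]-%ℕ-3 : ∀ c → -[1+ c ] %ℕ 3 ≡ (2 * suc c) % 3
-[1+]-%ℕ-3 c = trans residues (sym (%-distribˡ-* 2 (suc c) 3))
  where
  residues : -[1+ c ] %ℕ 3 ≡ (2 * (suc c % 3)) % 3
  -- `_%ℕ_` branches on this remainder for negative numbers, so each case computes once it is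
  -- abstracted.
  residues with suc c % 3 | m%n<n (suc c) 3
  ... | 0 | _ = refl
  ... | 1 | _ = refl
  ... | 2 | _ = refl
  ... | suc (suc (suc _)) | s≤s (s≤s (s≤s ()))

⊖-%ℕ-3 : ∀ a b → (a Int.⊖ b) %ℕ 3 ≡ (a + 2 * b) % 3
⊖-%ℕ-3 a b with ℕₚ.≤-<-connex b a
... | inj₁ b≤a = trans (cong (_%ℕ 3) (ℤₚ.⊖-≥ b≤a)) (trans (sym ([m+kn]%n≡m%n (a ∸ b) b 3))
      (cong (_% 3) (trans (lemma (a ∸ b) b) (cong (_+ 2 * b) (ℕₚ.m∸n+n≡m b≤a)))))
  where
  lemma : ∀ c b → c + b * 3 ≡ c + b + 2 * b
  lemma = solve-∀
... | inj₂ a<b with b ∸ suc a | ℕₚ.m+[n∸m]≡n a<b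
...   | c | refl = trans (cong (_%ℕ 3) (trans (ℤₚ.⊖-< a<b) (cong (λ x → Int.- (Int.+ x)) (diff a c))))
        -- With b = a + 1 + c the difference is -(c + 1), congruent to 2(c + 1), and adding 3a gives
        -- a + 2b.
        (trans (-[1+]-%ℕ-3 c) (trans (sym ([m+kn]%n≡m%n (2 * suc c) a 3)) (cong (_% 3) (lemma a c))))
  where
  diff : ∀ a c → suc a + c ∸ a ≡ suc c
  diff a c = trans (cong (_∸ a) (sym (+-suc a c))) (ℕₚ.m+n∸m≡n a (suc c))
  lemma : ∀ a c → 2 * suc c + a * 3 ≡ a + 2 * (suc a + c)
  lemma = solve-∀

pdRank-%ℕ-3 : ∀ {N} (p : DesignatedPartition N) → pdRank p %ℕ 3 ≡ rankFrom 1 (proj₁ p) % 3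
pdRank-%ℕ-3 p = trans (cong (_%ℕ 3) (ℤₚ.m-n≡m⊖n x y)) (⊖-%ℕ-3 x y)
  where
  x y : ℕ
  x = evenParts (proj₁ (Δ p))
  y = evenParts (proj₂ (Δ p))

-- The generating function

open PowerSeries eisenstein-ring
module E = CommutativeRing eisenstein-ring
module R = CommutativeRing series-ring
open Geometric series-ring
open SemigroupProperties R.*-commutativeSemigroup using (xy∙z≈y∙xz)
open Exp R.semiring using (^-homo-*; ^-assocʳ; ^-congˡ)

𝟙 : Series
𝟙 = constant 1#

term : ℕ → ℕ → Series
term e k = constant (ω^ e) ⊛ q ^ k

term-⊛ : ∀ e k f n → (term e k ⊛ f) n ≡ ω^ e ⊠ shift 0# k f n
term-⊛ e k f n = trans (⊛-assoc (constant (ω^ e)) (q ^ k) f n)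
  (trans (constant-⊛ (ω^ e) (q ^ k ⊛ f) n) (cong (ω^ e ⊠_) (q^-⊛ k f n)))

HasSeries : (w ρ : A → ℕ) → Series → Set
HasSeries w ρ f = Σ (ℕ → ℕ → ℕ) λ c → Counts w ρ c × generating c ≋ f

HasSeries-↔ : ∀ {w ρ : A → ℕ} {w′ ρ′ : B → ℕ} {f} (e : A ↔ B) →
  (∀ a → w a ≡ w′ (Inverse.to e a)) → (∀ a → ρ a ≡ ρ′ (Inverse.to e a)) →
  HasSeries w′ ρ′ f → HasSeries w ρ f
HasSeries-↔ e p r (c , F , c≋f) = c , (λ n j → ↔-trans (Fibre-cong e p r n j) (F n j)) , c≋f

HasSeries-⊤ : HasSeries {A = ⊤} (λ _ → 0) (λ _ → 0) 𝟙
HasSeries-⊤ = c , F , c≋𝟙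
  where
  indicator : ℕ → ℕ
  indicator zero    = 1
  indicator (suc _) = 0
  c : ℕ → ℕ → ℕ
  c zero    j = indicator (j % 3)
  c (suc n) j = 0
  F-zero : ∀ r → (⊤ × (0 ≡ 0 × r ≡ 0)) ↔ Fin (indicator r)
  F-zero zero    = ↔-trans (mk↔ₛ′ (λ _ → tt) (λ _ → tt , refl , refl) (λ _ → refl)
                     λ { (tt , refl , refl) → refl }) (↔-sym 1↔⊤)
  F-zero (suc r) = ↔-trans (mk↔ₛ′ (λ { (_ , _ , ()) }) (λ ()) (λ ()) (λ { (_ , _ , ()) })) (↔-sym 0↔⊥)
  F : Counts (λ _ → 0) (λ _ → 0) c
  F zero    j = ↔-trans Fibre-Σ (F-zero (j % 3))
  F (suc n) j = ↔-trans (mk↔ₛ′ (λ { (fibre _ (() , _)) }) (λ ()) (λ ())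
                  (λ { (fibre _ (() , _)) })) (↔-sym 0↔⊥)
  c≋𝟙 : generating c ≋ 𝟙
  c≋𝟙 zero    = refl
  c≋𝟙 (suc n) = refl

opaque
  -- 1 / (1 - ω^e q^(k+1))
  D : ℕ → ℕ → Series
  D e k = generating (proj₁ (count-ℕ (proj₁ (proj₂ HasSeries-⊤)) k e))

  -- The inverse of 1 - ω^e q^(k+1) is obtained by counting the multiplicities of a single part, so
  -- no inversion of power series has to be constructed.
  D-geometric : ∀ e k → D e k IsGeometricIn term e (suc k)
  D-geometric e k = geometric λ n → trans
    (proj₂ (proj₂ (count-ℕ (proj₁ (proj₂ HasSeries-⊤)) k e)) n)
    (cong₂ _⊞_ (proj₂ (proj₂ HasSeries-⊤) n) (sym (term-⊛ e (suc k) (D e k) n)))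

HasSeries-ℕ : ∀ {w ρ : A → ℕ} {f} k e → HasSeries w ρ f →
  HasSeries {A = ℕ × A} (λ (t , a) → t * suc k + w a) (λ (t , a) → t * e + ρ a) (D e k ⊛ f)
HasSeries-ℕ {f = f} k e (c , F , c≋f) with count-ℕ F k e
... | d , G , eq = d , G , geometric-* (D-geometric e k) λ n →
  trans (eq n) (cong₂ _⊞_ (c≋f n) (sym (term-⊛ e (suc k) (generating d) n)))

shift-≋ : ∀ {f g} → f ≋ g → ∀ k → shift 0# k f ≋ shift 0# k g
shift-≋ eq zero    n       = eq n
shift-≋ eq (suc k) zero    = refl
shift-≋ eq (suc k) (suc n) = shift-≋ eq k n

HasSeries-Bool : ∀ {w ρ : A → ℕ} {f} k e → HasSeries w ρ f →
  HasSeries {A = Bool × A} (λ (b , a) → (if b then k else 0) + w a)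
    (λ (b , a) → (if b then e else 0) + ρ a) ((𝟙 ⊕ term e k) ⊛ f)
HasSeries-Bool {f = f} k e (c , F , c≋f) with count-Bool F k e
... | d , G , eq = d , G , λ n → trans (eq n) (trans
  (cong₂ _⊞_ (trans (c≋f n) (sym (one-⊛ f n)))
    (trans (cong (ω^ e ⊠_) (shift-≋ c≋f k n)) (sym (term-⊛ e k f n))))
  (sym (⊛-distribʳ f 𝟙 (term e k) n)))

-- The factors contributed by part size k + 1, with ω² for ω^(-1).
X W Y : ℕ → Series
X k = D (even? (suc k)) k
W k = D 2 (k + suc (k + 0))
Y k = 𝟙 ⊕ term (2 * even? (suc k)) (3 * suc k)

HasSeries-partitions : ∀ k n →
  HasSeries (weightFrom (suc k) {n}) (rankFrom (suc k) {n}) (∏-from X W Y k n)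
HasSeries-partitions k zero    = HasSeries-↔
  (mk↔ₛ′ (λ _ → tt) (λ _ → []) (λ _ → refl) (λ { [] → refl })) (λ { [] → refl }) (λ { [] → refl })
  HasSeries-⊤
HasSeries-partitions k (suc n) = HasSeries-↔ (vec-↔ n)
  (weightFrom-code (suc k)) (rankFrom-code (suc k))
  -- `suc (k + suc (k + 0))` is what `2 * suc k` computes to, the weight of a pair; its rank 2
  -- stands for -1.
  (HasSeries-ℕ k (even? (suc k)) (HasSeries-ℕ (k + suc (k + 0)) 2
    (HasSeries-Bool (3 * suc k) (2 * even? (suc k)) (HasSeries-partitions (suc k) n))))

-- Coefficients at exponents 2 modulo 3, up to a bound

shift-view : ∀ k f m → shift 0# k f m ≡ 0# ⊎ Σ ℕ λ l → k + l ≡ m × shift 0# k f m ≡ f l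
shift-view zero    f m       = inj₂ (m , refl , refl)
shift-view (suc k) f zero    = inj₁ refl
shift-view (suc k) f (suc m) with shift-view k f m
... | inj₁ eq           = inj₁ eq
... | inj₂ (l , p , eq) = inj₂ (l , cong suc p , eq)

module _ (N : ℕ) where

  Vanishes : Series → Set
  Vanishes f = ∀ m → m ≤ N → m % 3 ≡ 2 → f m ≡ 0#

  -- The exponents k for which multiplying by 1 + ω^e q^k, or by 1 / (1 - ω^e q^k), preserves
  -- `Vanishes`: either residues are kept, or the effect lies above N.
  Negligible : ℕ → Set
  Negligible k = k % 3 ≡ 0 ⊎ N < k

  Vanishes-≋ : ∀ {f g} → f ≋ g → Vanishes f → Vanishes g
  Vanishes-≋ f≋g v m m≤N m≡2 = trans (sym (f≋g m)) (v m m≤N m≡2)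

  Vanishes-⊕ : ∀ {f g} → Vanishes f → Vanishes g → Vanishes (f ⊕ g)
  Vanishes-⊕ v w m m≤N m≡2 = cong₂ _⊞_ (v m m≤N m≡2) (w m m≤N m≡2)

  -- The condition on `f` is confined to the l with k + l = m, so that in `Vanishes-D` the induction
  -- hypothesis can supply it.
  term-vanishes : ∀ e k f → Negligible k → ∀ m → m ≤ N → m % 3 ≡ 2 →
    (∀ l → k + l ≡ m → l % 3 ≡ 2 → f l ≡ 0#) → (term e k ⊛ f) m ≡ 0#
  term-vanishes e k f negligible m m≤N m≡2 v =
    trans (term-⊛ e k f m)
    (trans (cong (ω^ e ⊠_) (shift≡0 (shift-view k f m) negligible)) (E.zeroʳ (ω^ e)))
    where
    shift≡0 : shift 0# k f m ≡ 0# ⊎ (Σ ℕ λ l → k + l ≡ m × shift 0# k f m ≡ f l) →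
      Negligible k → shift 0# k f m ≡ 0#
    shift≡0 (inj₁ eq)           _          = eq
    shift≡0 (inj₂ (l , p , eq)) (inj₁ k≡0) = trans eq (v l p (trans
      (trans (sym (m%n%n≡m%n l 3)) (trans (cong (λ r → (r + l % 3) % 3) (sym k≡0))
        (sym (%-distribˡ-+ k l 3)))) (trans (cong (_% 3) p) m≡2)))
    shift≡0 (inj₂ (l , p , eq)) (inj₂ N<k) = ⊥-elim (ℕₚ.<-irrefl refl
      (ℕₚ.<-≤-trans N<k (ℕₚ.≤-trans (ℕₚ.m≤m+n k l) (ℕₚ.≤-trans (ℕₚ.≤-reflexive p) m≤N))))

  Vanishes-+term : ∀ e k {f} → Negligible k → Vanishes f → Vanishes ((𝟙 ⊕ term e k) ⊛ f)
  Vanishes-+term e k {f} negligible v = Vanishes-≋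
    (R.sym (R.trans (⊛-distribʳ f 𝟙 (term e k)) (R.+-congʳ (R.*-identityˡ f))))
    (Vanishes-⊕ v λ m m≤N m≡2 → term-vanishes e k f negligible m m≤N m≡2
      λ { l refl → v l (ℕₚ.≤-trans (ℕₚ.m≤n+m l k) m≤N) })

  D-unfold : ∀ e k f → D e k ⊛ f ≋ f ⊕ term e (suc k) ⊛ (D e k ⊛ f)
  D-unfold e k f = geometric-unfold-* f (D-geometric e k)

  Vanishes-D : ∀ e k {f} → Negligible (suc k) → Vanishes f → Vanishes (D e k ⊛ f)
  Vanishes-D e k {f} negligible v = <-rec _ λ m rec m≤N m≡2 → trans (D-unfold e k f m)
    (cong₂ _⊞_ (v m m≤N m≡2) (term-vanishes e (suc k) (D e k ⊛ f) negligible m m≤N m≡2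
      λ { l refl l≡2 → rec (s≤s (ℕₚ.m≤n+m l k)) (ℕₚ.≤-trans (ℕₚ.m≤n+m l (suc k)) m≤N) l≡2 }))

  -- `f` differs from `D e k ⊛ f` by a negligible multiple of the latter. This serves to strike out
  -- factors that were only inserted.
  Vanishes-D⁻¹ : ∀ e k {f} → Negligible (suc k) → Vanishes (D e k ⊛ f) → Vanishes f
  Vanishes-D⁻¹ e k {f} negligible v m m≤N m≡2 = trans (sym (E.+-identityʳ (f m))) (trans
    (cong (f m ⊞_) (sym (term-vanishes e (suc k) (D e k ⊛ f) negligible m m≤N m≡2
      λ { l refl → v l (ℕₚ.≤-trans (ℕₚ.m≤n+m l (suc k)) m≤N) })))
    (trans (sym (D-unfold e k f m)) (v m m≤N m≡2)))

  Vanishes-q^ : ∀ e → e % 3 ≢ 2 → Vanishes (q ^ e)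
  Vanishes-q^ e e≢2 m m≤N m≡2 = trans (sym (R.*-identityʳ (q ^ e) m)) (trans (q^-⊛ e 𝟙 m) shift≡0)
    where
    shift≡0 : shift 0# e 𝟙 m ≡ 0#
    shift≡0 with shift-view e 𝟙 m
    ... | inj₁ eq                  = eq
    ... | inj₂ (zero  , refl , _)  = ⊥-elim (e≢2 (trans (cong (_% 3) (sym (+-identityʳ e))) m≡2))
    ... | inj₂ (suc l , refl , eq) = eq

-- Gauss' product has no exponents 2 modulo 3

open Shanks series-ring q using (q^2*; module Quotients)

q^-double : ∀ j → q ^ (j * 2) ≋ q^2* j
q^-double zero    = R.refl
q^-double (suc j) = R.trans (R.sym (R.*-assoc q q (q ^ (j * 2)))) (R.*-congˡ (q^-double j))

geometric-≋ : ∀ {d x y} → x ≋ y → d IsGeometricIn x → d IsGeometricIn y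
geometric-≋ x≋y g = geometric (R.trans (unfold g) (R.+-congˡ (R.*-congʳ x≋y)))

-- `ratio j` is the factor (1 - q^(2j+2)) / (1 - q^(2j+1)) of Gauss' product.
D-odd ratio : ℕ → Series
D-odd j = D 0 (j * 2)
ratio j = D-odd j R.- q ⊛ q ⊛ q^2* j ⊛ D-odd j

D-odd-geometric : ∀ j → D-odd j IsGeometricIn q ⊛ q^2* j
D-odd-geometric j =
  geometric-≋ (R.trans (R.*-identityˡ _) (R.*-congˡ (q^-double j))) (D-geometric 0 (j * 2))

ratio-equation : ∀ j → ratio j ⊕ q ⊛ q ⊛ q^2* j ⊛ D-odd j ≋ D-odd j
ratio-equation j = R.trans (R.+-assoc (D-odd j) _ _)
  (R.trans (R.+-congˡ (R.-‿inverseˡ (q ⊛ q ⊛ q^2* j ⊛ D-odd j))) (R.+-identityʳ (D-odd j)))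

period-3 : (f g : ℕ → ℕ) → (∀ n → f (3 + n) ≡ f n + g n * 3) →
  f 0 % 3 ≢ 2 → f 1 % 3 ≢ 2 → f 2 % 3 ≢ 2 → ∀ n → f n % 3 ≢ 2
period-3 f g step f₀ f₁ f₂ 0 = f₀
period-3 f g step f₀ f₁ f₂ 1 = f₁
period-3 f g step f₀ f₁ f₂ 2 = f₂
period-3 f g step f₀ f₁ f₂ (suc (suc (suc n))) eq = period-3 f g step f₀ f₁ f₂ n
  (trans (sym (trans (cong (_% 3) (step n)) ([m+kn]%n≡m%n (f n) (g n) 3))) eq)

open Quotients D-odd D-odd-geometric ratio ratio-equation using (S; S-suc; B≡∏)

Vanishes-S : ∀ N n → Vanishes N (S n)
Vanishes-S N zero    m _ _ = refl
Vanishes-S N (suc n) = Vanishes-≋ N (R.sym (S-suc n))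
  (Vanishes-⊕ N (Vanishes-⊕ N (Vanishes-S N n) (monomial n (lower n))) (monomial (suc n) (upper n)))
  where
  monomial : ∀ i → (suc (n * 2) * i) % 3 ≢ 2 → Vanishes N ((q ⊛ q^2* n) ^ i)
  monomial i i≢2 = Vanishes-≋ N
    (R.trans (R.sym (^-assocʳ q (suc (n * 2)) i)) (^-congˡ i (R.*-congˡ (q^-double n))))
    (Vanishes-q^ N (suc (n * 2) * i) i≢2)
  lower : ∀ n → (suc (n * 2) * n) % 3 ≢ 2
  -- n(2n + 1) grows by 3(4n + 7) over three steps, and its first residues are 0, 0, 1. Below, (n +
  -- 1)(2n + 1) grows by 3(4n + 9), with residues 1, 0, 0.
  lower = period-3 (λ n → suc (n * 2) * n) (λ n → 4 * n + 7) step (λ ()) (λ ()) (λ ())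
    where
    step : ∀ n → suc ((3 + n) * 2) * (3 + n) ≡ suc (n * 2) * n + (4 * n + 7) * 3
    step = solve-∀
  upper : ∀ n → (suc (n * 2) * suc n) % 3 ≢ 2
  upper = period-3 (λ n → suc (n * 2) * suc n) (λ n → 4 * n + 9) step (λ ()) (λ ()) (λ ())
    where
    step : ∀ n → suc ((3 + n) * 2) * suc (3 + n) ≡ suc (n * 2) * suc n + (4 * n + 9) * 3
    step = solve-∀

-- Shanks' sum differs from the product only from q^(2N+1) on, beyond the bound N.
Vanishes-ratio : ∀ N → Vanishes N (∏ ratio N)
Vanishes-ratio zero    .zero z≤n ()
Vanishes-ratio (suc s) m m≤N m≡2 with B≡∏ (q ⊛ q^2* (suc s)) s
... | h , eq = trans (sym (E.+-identityʳ _)) (trans (cong (∏ ratio (suc s) m ⊞_) (sym remainder))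
                 (trans (sym (eq m)) (Vanishes-S (suc s) (suc s) m m≤N m≡2)))
  where
  k : ℕ
  k = suc (suc s * 2)
  remainder : (q ⊛ q^2* (suc s) ⊛ h) m ≡ 0#
  remainder = trans
    (R.*-congʳ {x = h} (R.trans (R.sym (R.*-congˡ (q^-double (suc s)))) (R.sym (R.*-identityˡ (q ^ k)))) m)
    -- Nothing is known about `h`, but k = 2(s + 1) + 1 exceeds the bound, so no l satisfies k + l =
    -- m.
    (term-vanishes (suc s) 0 k h (inj₂ (s≤s (ℕₚ.m≤m*n (suc s) 2))) m m≤N m≡2 λ l k+l≡m →
      ⊥-elim (ℕₚ.<-irrefl refl (ℕₚ.≤-trans (s≤s (ℕₚ.m≤m*n (suc s) 2))
        (ℕₚ.≤-trans (ℕₚ.≤-trans (ℕₚ.m≤m+n k l) (ℕₚ.≤-reflexive k+l≡m)) m≤N))))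

-- Cancelling pairs of size j against the even size 2j

ζ : Series
ζ = constant ω

ζ-⊛ : ∀ n → (ζ ⊛ ζ) n ≡ constant (ω ⊠ ω) n
ζ-⊛ zero    = refl
ζ-⊛ (suc n) = constant-⊛ ω ζ (suc n)

ζ-sum : 𝟙 ⊕ ζ ⊕ ζ ⊛ ζ ≋ R.0#
ζ-sum zero    = refl
ζ-sum (suc n) = cong (0# ⊞ 0# ⊞_) (ζ-⊛ (suc n))

ζ-cube : ζ ⊛ (ζ ⊛ ζ) ≋ 𝟙
ζ-cube zero    = refl
ζ-cube (suc n) = trans (constant-⊛ ω (ζ ⊛ ζ) (suc n)) (cong (ω ⊠_) (ζ-⊛ (suc n)))

-- 1 / (1 - q^(6j+6)): the exponent is one more than the index and computes to three times
-- `suc j * 2`.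
cube : ℕ → Series
cube j = D 0 (suc (j * 2) + suc j * 2 + suc j * 2)

cube-geometric : ∀ j → cube j IsGeometricIn q^2* (suc j) ⊛ q^2* (suc j) ⊛ q^2* (suc j)
cube-geometric j = geometric-≋ (R.trans (R.*-identityˡ _)
  (R.trans (^-homo-* q (y + y) y) (R.*-cong (R.trans (^-homo-* q y y) (R.*-cong eq eq)) eq)))
  (D-geometric 0 (suc (j * 2) + y + y))
  where
  y : ℕ
  y = suc j * 2
  eq : q ^ y ≋ q^2* (suc j)
  eq = q^-double (suc j)

-- Index k belongs to part size k + 1, so an even index means an odd size and e = 0.
X-even : ∀ j → X (j * 2) ≡ D-odd j
X-even j = cong (λ e → D e (j * 2)) (trans (cong even? (+-comm 1 (j * 2))) (even?-+2* j 1))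

X-odd : ∀ j → X (suc (j * 2)) IsGeometricIn ζ ⊛ q^2* (suc j)
X-odd j = subst (λ e → D e (suc (j * 2)) IsGeometricIn ζ ⊛ q^2* (suc j))
  (sym (trans (cong even? (sym (+-identityʳ (suc j * 2)))) (even?-+2* (suc j) 0)))
  (geometric-≋ (R.*-congˡ (q^-double (suc j))) (D-geometric 1 (suc (j * 2))))

W-geometric : ∀ j → W j IsGeometricIn ζ ⊛ ζ ⊛ q^2* (suc j)
W-geometric j = geometric-≋ (R.*-cong (R.sym ζ-⊛)
  (R.trans (R.reflexive (cong (q ^_) (ℕₚ.*-comm 2 (suc j)))) (q^-double (suc j))))
  (D-geometric 2 (j + suc (j + 0)))

-- With x = q^(2j+2), the two factors in ω and ω² multiply to (1 - x) `cube j`, and 1 - x is just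
-- the numerator that `D-odd j` lacks to become `ratio j`.
∏-X-W : ∀ n → ∏ X (n * 2) ⊛ ∏ W n ≋ ∏ cube n ⊛ ∏ ratio n
∏-X-W = ∏-regroup λ j → R.trans (R.*-congʳ (R.reflexive (X-even j)))
  (exchange {x = q^2* (suc j)} (ratio-equation j)
    (geometric-cube ζ-sum ζ-cube (X-odd j) (W-geometric j) (cube-geometric j)))

module _ (N : ℕ) where

  Vanishes-∏ : ∀ (f : ℕ → Series) {g} → (∀ i {h} → Vanishes N h → Vanishes N (f i ⊛ h)) →
    ∀ n → Vanishes N g → Vanishes N (∏ f n ⊛ g)
  Vanishes-∏ f step zero    v = Vanishes-≋ N (R.sym (R.*-identityˡ _)) v
  Vanishes-∏ f {g} step (suc n) v = Vanishes-≋ N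
    (R.sym (xy∙z≈y∙xz (∏ f n) (f n) g))
    (step n (Vanishes-∏ f step n v))

  -- The factors removed belong to part sizes above N.
  Vanishes-drop-X : ∀ {g} i → Vanishes N (∏ X (i + N) ⊛ g) → Vanishes N (∏ X N ⊛ g)
  Vanishes-drop-X zero        v = v
  Vanishes-drop-X {g} (suc i) v = Vanishes-drop-X i
    (Vanishes-D⁻¹ N _ (i + N) (inj₂ (s≤s (ℕₚ.m≤n+m N i))) (Vanishes-≋ N
      (xy∙z≈y∙xz (∏ X (i + N)) (X (i + N)) g) v))

  Vanishes-partitions : Vanishes N (∏-from X W Y 0 N)
  Vanishes-partitions = Vanishes-≋ N (R.sym (∏-from-0 X W Y N))
    (Vanishes-∏ Y (λ i → Vanishes-+term N (2 * even? (suc i)) (3 * suc i)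
        (inj₁ (trans (cong (_% 3) (ℕₚ.*-comm 3 (suc i))) (m*n%n≡0 (suc i) 3)))) N
      -- Index N + N is what `∏-X-W` requires to match all N factors `W`.
      (Vanishes-drop-X N (Vanishes-≋ N
        (R.*-congʳ (R.reflexive (cong (∏ X) (double N))))
        (Vanishes-≋ N (R.sym (∏-X-W N))
          (Vanishes-∏ cube (λ j → Vanishes-D N 0 _
            (inj₁ (trans (cong (_% 3) (triple (suc j * 2))) (m*n%n≡0 (suc j * 2) 3)))) N
            (Vanishes-ratio N))))))
    where
    double : ∀ n → n * 2 ≡ n + n
    double = solve-∀
    triple : ∀ n → n + n + n ≡ n * 3
    triple = solve-∀

-- From the weighted count to the rank classes

Opposite : ℕ → ℕ → Set
Opposite i j = ∀ r → (r % 3 ≡ i → (r + j) % 3 ≡ 0) × ((r + j) % 3 ≡ 0 → r % 3 ≡ i)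

opposite : ∀ {i j} → (i + j) % 3 ≡ 0 → (∀ s → s < 3 → (s + j) % 3 ≡ 0 → s ≡ i) → Opposite i j
opposite {i} {j} i+j≡0 unique r =
  (λ r≡i → trans reduce (trans (cong (λ s → (s + j) % 3) r≡i) i+j≡0)) ,
  (λ r+j≡0 → unique (r % 3) (m%n<n r 3) (trans (sym reduce) r+j≡0))
  where
  reduce : (r + j) % 3 ≡ (r % 3 + j) % 3
  reduce = trans (%-distribˡ-+ r j 3) (trans (cong (λ s → (s + j % 3) % 3) (sym (m%n%n≡m%n r 3)))
    (sym (%-distribˡ-+ (r % 3) j 3)))

RankClass-Fibre : ∀ N {i j} → Opposite i j → RankClass N i ↔ Fibre (weightFrom 1 {N}) (rankFrom 1) N j
RankClass-Fibre N {i} {j} opp = ↔-trans Σ-assoc (↔-trans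
  (Σ-↔ ↔-refl λ {v} → irrelevant-↔ (irrelevant v) Fibre-irrelevant
    (λ (p , r) → p , proj₁ (opp (rankFrom 1 v)) (trans (sym (pdRank-%ℕ-3 (v , p))) r))
    (λ (p , r) → p , trans (pdRank-%ℕ-3 (v , p)) (proj₂ (opp (rankFrom 1 v)) r)))
  (↔-sym Fibre-Σ))
  where
  irrelevant : (v : Vec Slot N) →
    Irrelevant (Σ (weightFrom 1 v ≡ N) λ p → pdRank {N} (v , p) %ℕ 3 ≡ i)
  irrelevant v (p , r) (p′ , r′) with ℕₚ.≡-irrelevant p p′
  ... | refl = cong (p ,_) (ℕₚ.≡-irrelevant r r′)

module _ (N : ℕ) (N%3≡2 : N % 3 ≡ 2) where

  private
    partitions : HasSeries (weightFrom 1 {N}) (rankFrom 1) (∏-from X W Y 0 N)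
    partitions = HasSeries-partitions 0 N

    c : ℕ → ℕ → ℕ
    c = proj₁ partitions

  class-sizes : c N 0 ≡ c N 1 × c N 2 ≡ c N 1
  class-sizes = evaluate≡0 (c N)
    (trans (proj₂ (proj₂ partitions) N) (Vanishes-partitions N N ℕₚ.≤-refl N%3≡2))

  class : ∀ {i j} → Opposite i j → RankClass N i ↔ Fin (c N j)
  class {j = j} opp = ↔-trans (RankClass-Fibre N opp) (proj₁ (proj₂ partitions) N j)

  class₀ : RankClass N 0 ↔ Fin (c N 0)
  class₀ = class (opposite refl λ
    { 0 _ _ → refl ; 1 _ () ; 2 _ () ; (suc (suc (suc _))) (s≤s (s≤s (s≤s ()))) })

  -- `Fibre` records the negative of the rank, so ranks 1 and 2 are counted at j = 2 and j = 1.
  class₁ : RankClass N 1 ↔ Fin (c N 2)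
  class₁ = class (opposite refl λ
    { 0 _ () ; 1 _ _ → refl ; 2 _ () ; (suc (suc (suc _))) (s≤s (s≤s (s≤s ()))) })

  class₂ : RankClass N 2 ↔ Fin (c N 1)
  class₂ = class (opposite refl λ
    { 0 _ () ; 1 _ () ; 2 _ _ → refl ; (suc (suc (suc _))) (s≤s (s≤s (s≤s ()))) })

  class-bijections : (RankClass N 0 ↔ RankClass N 1) × (RankClass N 1 ↔ RankClass N 2)
  class-bijections =
    ↔-trans class₀ (↔-trans (Fin-≡ (trans (proj₁ class-sizes) (sym (proj₂ class-sizes)))) (↔-sym class₁)) ,
    ↔-trans class₁ (↔-trans (Fin-≡ (proj₂ class-sizes)) (↔-sym class₂))
    where
    Fin-≡ : ∀ {a b} → a ≡ b → Fin a ↔ Fin b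
    Fin-≡ refl = ↔-refl

theorem3p4 : (n : ℕ) →
    (RankClass (3 * n + 2) 0 ↔ RankClass (3 * n + 2) 1) ×
    (RankClass (3 * n + 2) 1 ↔ RankClass (3 * n + 2) 2)
theorem3p4 n = class-bijections (3 * n + 2) (trans (cong (_% 3) (lemma n)) ([m+kn]%n≡m%n 2 n 3))
  where
  lemma : ∀ n → 3 * n + 2 ≡ 2 + n * 3
  lemma = solve-∀
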